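{- For every fixed integer $t\geqslant 2$, the $t$-Local Search algorithm runs in polynomial time and is an $O(\mathrm{OPT}^{1-1/t})$-approximation algorithm for MIS on graphs with no induced subgraph isomorphic to $K_{t,t}$.
   Context: All graphs are finite and simple; $K_{t,t}$ is the complete bipartite graph with $t$ vertices on each side. MIS is the Maximum Independent Set problem; $\mathrm{OPT}=\alpha(G)$ is the maximum size of an independent set of the input graph $G$; a $\rho$-approximation outputs an independent set of size at least $\mathrm{OPT}/\rho$. The $t$-Local Search algorithm, on input $G=(V,E)$, starts with an independent set $S$ consisting of a single vertex, and, as long as there exist sets $X\subseteq S$ (possibly empty) and $Y\subseteq V\setminus S$ with $0\leqslant |X|<|Y|\leqslant t$ such that $(S\setminus X)\cup Y$ is an independent set, replaces $S$ by $(S\setminus X)\cup Y$ (choosing arbitrarily among such pairs); when no such improvement exists it outputs $S$. -}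

module Defs where

open import Data.Bool using (Bool; true; false; if_then_else_)
open import Data.Fin using (Fin; toℕ; fromℕ<)
open import Data.Fin.Subset using (Subset; _∈_; _⊆_; _∪_; _─_; ∁; ∣_∣; ⁅_⁆)
open import Data.Nat using (ℕ; zero; suc; _+_; _*_; _∸_; _^_; _≤_; _<_; _⊓_; _≡ᵇ_; _<?_)
open import Data.Product using (Σ; ∃; ∃-syntax; _×_)
open import Data.Sum using (_⊎_; inj₁; inj₂)
open import Data.Vec using (lookup)
open import Function.Definitions using (Injective)
open import Relation.Binary.Construct.Closure.ReflexiveTransitive using (Star)
open import Relation.Binary.PropositionalEquality using (_≡_; _≢_; refl)
open import Relation.Nullary using (¬_; yes; no)

record Graph (V : Set) : Set where
  field
    adj         : V → V → Bool
    symmetric   : ∀ u v → adj u v ≡ adj v u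
    irreflexive : ∀ v → adj v v ≡ false

open Graph public

K : (s t : ℕ) → Graph (Fin s ⊎ Fin t)
K s t = record { adj = a ; symmetric = a-sym ; irreflexive = a-irr }
  where
  a : Fin s ⊎ Fin t → Fin s ⊎ Fin t → Bool
  a (inj₁ _) (inj₁ _) = false
  a (inj₁ _) (inj₂ _) = true
  a (inj₂ _) (inj₁ _) = true
  a (inj₂ _) (inj₂ _) = false

  a-sym : ∀ u v → a u v ≡ a v u
  a-sym (inj₁ _) (inj₁ _) = refl
  a-sym (inj₁ _) (inj₂ _) = refl
  a-sym (inj₂ _) (inj₁ _) = refl
  a-sym (inj₂ _) (inj₂ _) = refl

  a-irr : ∀ v → a v v ≡ false
  a-irr (inj₁ _) = refl
  a-irr (inj₂ _) = refl

HasInduced : {V W : Set} → Graph V → Graph W → Set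
HasInduced {V} {W} G H =
  Σ (W → V) λ f → Injective _≡_ _≡_ f × (∀ x y → adj G (f x) (f y) ≡ adj H x y)

private
  variable
    n : ℕ

Independent : Graph (Fin n) → Subset n → Set
Independent G S = ∀ {u v} → u ∈ S → v ∈ S → adj G u v ≡ false

IsOPT : Graph (Fin n) → ℕ → Set
IsOPT G a =
  (∃[ I ] (Independent G I × ∣ I ∣ ≡ a)) × (∀ I → Independent G I → ∣ I ∣ ≤ a)

record Improvement (t : ℕ) (G : Graph (Fin n)) (S S′ : Subset n) : Set where
  field
    X Y         : Subset n
    X⊆S         : X ⊆ S
    Y⊆V∖S       : Y ⊆ ∁ S
    ∣X∣<∣Y∣     : ∣ X ∣ < ∣ Y ∣
    ∣Y∣≤t       : ∣ Y ∣ ≤ t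
    exchange    : S′ ≡ (S ─ X) ∪ Y
    independent : Independent G S′

LocallyOptimal : ℕ → Graph (Fin n) → Subset n → Set
LocallyOptimal t G S = ¬ (∃[ S′ ] Improvement t G S S′)

OutputFrom : ℕ → Graph (Fin n) → Fin n → Subset n → Set
OutputFrom t G v S = Star (Improvement t G) ⁅ v ⁆ S × LocallyOptimal t G S

Output : ℕ → Graph (Fin n) → Subset n → Set
Output t G S = ∃[ v ] OutputFrom t G v S

-- Time is measured on a unit-cost random-access machine with registers, a
-- memory, and a read-only adjacency matrix.  There is no multiplication, so
-- after k instructions every number in use has O(k + log n) bits (n being the
-- number of vertices): polynomial time here is polynomial time on a Turing
-- machine.

Reg : Set
Reg = ℕ

data Expr : Set where
  const   : ℕ → Expr
  var     : Reg → Expr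
  _⊕_ _⊖_ : Reg → Reg → Expr
  load    : Reg → Expr
  edge    : Reg → Reg → Expr

infix  6 _≔_ mem[_]≔_
infixr 5 _⨾_

data Cmd : Set where
  skip     : Cmd
  _≔_      : Reg → Expr → Cmd
  mem[_]≔_ : Reg → Reg → Cmd
  -- choose x y sets x to an arbitrary number that is at most the value of y.
  choose   : Reg → Reg → Cmd
  _⨾_      : Cmd → Cmd → Cmd
  cond     : Reg → Cmd → Cmd → Cmd
  while    : Reg → Cmd → Cmd

-- The tape holds the outcomes of the future arbitrary choices; quantifying
-- over tapes quantifies over all ways of making them.
record State : Set where
  constructor ⟪_,_,_⟫
  field
    reg mem tape : ℕ → ℕ

open State public

_[_↦_] : (ℕ → ℕ) → ℕ → ℕ → (ℕ → ℕ)
(f [ i ↦ a ]) j = if j ≡ᵇ i then a else f j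

setReg : Reg → ℕ → State → State
setReg x a s = record s { reg = reg s [ x ↦ a ] }

bit : Bool → ℕ
bit b = if b then 1 else 0

edgeBit : Graph (Fin n) → ℕ → ℕ → ℕ
edgeBit {n} G i j with i <? n | j <? n
... | yes i<n | yes j<n = bit (adj G (fromℕ< i<n) (fromℕ< j<n))
... | _       | _       = 0

eval : Graph (Fin n) → Expr → State → ℕ
eval G (const a)  s = a
eval G (var x)    s = reg s x
eval G (x ⊕ y)    s = reg s x + reg s y
eval G (x ⊖ y)    s = reg s x ∸ reg s y
eval G (load x)   s = mem s (reg s x)
eval G (edge x y) s = edgeBit G (reg s x) (reg s y)

infix 4 _⊢⟨_,_⟩⇓⟨_,_⟩

-- G ⊢⟨ c , s ⟩⇓⟨ s′ , k ⟩: started in state s on input graph G, the command c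
-- halts in state s′ after k steps.
data _⊢⟨_,_⟩⇓⟨_,_⟩ {n} (G : Graph (Fin n)) : Cmd → State → State → ℕ → Set where
  skip⇓ : ∀ {s} → G ⊢⟨ skip , s ⟩⇓⟨ s , 1 ⟩
  ≔⇓ : ∀ {x e s} → G ⊢⟨ x ≔ e , s ⟩⇓⟨ setReg x (eval G e s) s , 1 ⟩
  mem⇓ : ∀ {x y s} →
    G ⊢⟨ mem[ x ]≔ y , s ⟩⇓⟨ record s { mem = mem s [ reg s x ↦ reg s y ] } , 1 ⟩
  choose⇓ : ∀ {x y s} →
    G ⊢⟨ choose x y , s ⟩⇓⟨ setReg x (tape s 0 ⊓ reg s y)
                              (record s { tape = λ i → tape s (suc i) }) , 1 ⟩
  ⨾⇓ : ∀ {c d s s′ s″ k l} →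
    G ⊢⟨ c , s ⟩⇓⟨ s′ , k ⟩ → G ⊢⟨ d , s′ ⟩⇓⟨ s″ , l ⟩ →
    G ⊢⟨ c ⨾ d , s ⟩⇓⟨ s″ , k + l ⟩
  cond-then⇓ : ∀ {x c d s s′ k} → reg s x ≢ 0 →
    G ⊢⟨ c , s ⟩⇓⟨ s′ , k ⟩ → G ⊢⟨ cond x c d , s ⟩⇓⟨ s′ , suc k ⟩
  cond-else⇓ : ∀ {x c d s s′ k} → reg s x ≡ 0 →
    G ⊢⟨ d , s ⟩⇓⟨ s′ , k ⟩ → G ⊢⟨ cond x c d , s ⟩⇓⟨ s′ , suc k ⟩
  while-stop⇓ : ∀ {x c s} → reg s x ≡ 0 → G ⊢⟨ while x c , s ⟩⇓⟨ s , 1 ⟩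
  while-loop⇓ : ∀ {x c s s′ s″ k l} → reg s x ≢ 0 →
    G ⊢⟨ c , s ⟩⇓⟨ s′ , k ⟩ → G ⊢⟨ while x c , s′ ⟩⇓⟨ s″ , l ⟩ →
    G ⊢⟨ while x c , s ⟩⇓⟨ s″ , suc (k + l) ⟩

order start found : Reg
order = 0
start = 1
found = 2

localSearch : Cmd → Cmd
localSearch improve =
  found ≔ const 1 ⨾
  mem[ start ]≔ found ⨾
  while found improve

initial : (n : ℕ) → Fin n → (ℕ → ℕ) → State
initial n v ω = ⟪ (λ _ → 0) [ order ↦ n ] [ start ↦ toℕ v ] , (λ _ → 0) , ω ⟫

-- The current set occupies the first n memory cells, as a characteristic
-- vector; all other cells and all registers but order are free for use.
Holds : Subset n → State → Set
Holds {n} S s = reg s order ≡ n × (∀ v → mem s (toℕ v) ≡ bit (lookup S v))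

-- The command replaces the current independent set S by an improvement and
-- makes found nonzero, or keeps S and zeroes found when there is none.  Since
-- t-Local Search picks its improvement arbitrarily, every improvement has to
-- be a possible outcome.
record Improves (t : ℕ) (improve : Cmd) : Set where
  field
    step : ∀ {n} (G : Graph (Fin n)) S → Independent G S → ∀ s → Holds S s →
      ∃[ s′ ] ∃[ k ] (G ⊢⟨ improve , s ⟩⇓⟨ s′ , k ⟩ ×
        ((reg s′ found ≢ 0 × (∃[ S′ ] (Improvement t G S S′ × Holds S′ s′)))
          ⊎ (reg s′ found ≡ 0 × LocallyOptimal t G S × Holds S s′)))
    any-choice : ∀ {n} (G : Graph (Fin n)) S → Independent G S →
      ∀ S′ → Improvement t G S S′ → ∀ s → Holds S s →
      ∃[ ω ] ∃[ s′ ] ∃[ k ] (G ⊢⟨ improve , record s { tape = ω } ⟩⇓⟨ s′ , k ⟩ ×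
        reg s′ found ≢ 0 × Holds S′ s′)

RunsInPolynomialTime : ℕ → Set
RunsInPolynomialTime t =
  ∃[ improve ] (Improves t improve × (∃[ c ] ∃[ d ]
    (∀ {n} (G : Graph (Fin n)) (v : Fin n) (ω : ℕ → ℕ) →
      ∃[ s ] ∃[ k ] (G ⊢⟨ localSearch improve , initial n v ω ⟩⇓⟨ s , k ⟩ ×
        k ≤ c * n ^ d ×
        (∃[ S ] (OutputFrom t G v S × Holds S s))))))

-- a ≤ ρ · m for ρ = C · a^(1 - 1/t), with both sides raised to the power t.
WithinRatio : (t C a m : ℕ) → Set
WithinRatio t C a m = a ^ t ≤ C ^ t * a ^ (t ∸ 1) * m ^ t

ApproximatesMIS : ℕ → Set
ApproximatesMIS t =
  ∃[ C ] (∀ {n} (G : Graph (Fin n)) → ¬ HasInduced G (K t t) →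
    ∀ S → Output t G S → ∀ opt → IsOPT G opt →
      Independent G S × WithinRatio t C opt ∣ S ∣)

{-# OPTIONS --safe #-}

-- Ratio: let S be locally optimal and I independent. Give each v in I ∖ S the list of its first t
-- neighbours in S. At most (1 + |S|)^t lists occur, and each belongs to at most t vertices: t vertices
-- sharing a list of length t would induce K t t, and a shorter list y is the whole neighbourhood in S,
-- so that |y| + 1 vertices sharing it could be exchanged for y. Hence |I| = O(|S|^t).
--
-- Time: an improvement of S is the same as an independent S′ with |S| < |S′| obtained from S by t
-- deletions followed by t insertions (repetitions allowed). The program first tries 2t arbitrarily
-- chosen positions, which makes every improvement possible, and then, if that failed, all 2t-tuples of
-- vertices. Each improvement enlarges S, so there are at most n of them.

module Submission where

open import Defs
open import Data.Nat using (ℕ; _≤_)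
open import Data.Product using (_×_)
import Algebra.Properties.CommutativeSemigroup as CommutativeSemigroup
open import Data.Bool using (Bool; true; false; if_then_else_; _∨_; T)
import Data.Bool.Properties as Bool
open import Data.Fin using (Fin; zero; suc; toℕ; fromℕ<; inject≤)
open import Data.Fin.Properties using (inject≤-injective)
import Data.Fin.Properties as Fin
open import Data.Fin.Subset
  using (Subset; inside; outside; _∈_; _∉_; _⊆_; _∪_; _─_; ∣_∣; ⁅_⁆)
  renaming (⊥ to ∅)
open import Data.Fin.Subset.Properties
  using (x∈⁅x⁆; x∈⁅y⁆⇒x≡y; x∈p∪q⁺; x∈p∪q⁻; x∈p∧x∉q⇒x∈p─q; p─q⊆p; x∈p∧x≢y⇒x∈p-y;
         x∈p⇒∣p-x∣<∣p∣; x∈∁p⇒x∉p; x∉p⇒x∈∁p; ∣⁅x⁆∣≡1; ∣⊥∣≡0; ∉⊥; _∈?_; ∣p∣≤n; ⊆-antisym)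
open import Data.List using (List; []; _∷_; length; map; filter; take; foldr; cartesianProductWith)
import Data.List as List
open import Data.List.Membership.Propositional using () renaming (_∈_ to _∈ₗ_)
open import Data.List.Membership.Propositional.Properties
  using (∈-map⁺; ∈-map⁻; ∈-filter⁺; ∈-filter⁻; ∈-cartesianProductWith⁺; ∈-lookup)
open import Data.List.Properties using (length-map; length-take; length-++; ≡-dec)
open import Data.List.Relation.Unary.All using ([]; _∷_)
import Data.List.Relation.Unary.All as All
import Data.List.Relation.Unary.All.Properties as All
open import Data.List.Relation.Unary.AllPairs using ([]; _∷_)
open import Data.List.Relation.Unary.Any using (here; there)
open import Data.List.Relation.Unary.Unique.Propositional using (Unique)
import Data.List.Relation.Unary.Unique.Propositional.Properties as Unique
open import Data.Nat using (zero; suc; _+_; _*_; _∸_; _^_; _<_; _⊓_; _≡ᵇ_; _<?_; _≤?_; z≤n; s≤s)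
open import Data.Nat.Properties hiding (suc-injective; _<?_; _≤?_)
open import Data.Product using (Σ; ∃-syntax; _,_; proj₁; proj₂)
open import Data.Sum using (_⊎_; inj₁; inj₂; [_,_]′)
open import Data.Unit using (⊤; tt)
open import Data.Vec using ([]; _∷_; lookup; here; there)
open import Data.Vec.Properties using ([]=⇒lookup; lookup⇒[]=)
open import Function using (_∘_)
open import Function.Definitions using (Injective)
open import Relation.Binary.Construct.Closure.ReflexiveTransitive using (Star; ε; _◅_)
open import Relation.Binary.Definitions using (DecidableEquality)
open import Relation.Binary.PropositionalEquality
open import Relation.Nullary using (¬_; ¬?; yes; no; Dec; contradiction)

-- Once |I| is at most C |S|^t, the ratio needs no roots: replacing a single factor of OPT^t by C
-- |S|^t gives OPT^t at most C |S|^t OPT^(t-1), the claimed bound raised to the power t. The time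
-- half must exhibit a program that halts on every tape and can still realise every improvement.
-- Guessing alone may miss and cannot certify local optimality; exhaustive search alone always
-- returns the same improvement. The combination meets both demands. The format of 2t slots replaces
-- pairs X, Y of varying size by tuples of one fixed length, which nested counted loops can
-- enumerate; the size limit on Y then holds automatically, so that only independence and
-- cardinality have to be tested. The programs are written in a sublanguage whose loops run n times,
-- so they denote total functions, and correctness is separated from the construction of executions
-- and their costs.

private
  variable
    n   : ℕ
    A B : Set

-- Finite sets as lists

elements : Subset n → List (Fin n)
elements []            = []
elements (inside  ∷ p) = zero ∷ map suc (elements p)
elements (outside ∷ p) = map suc (elements p)

length-elements : (p : Subset n) → length (elements p) ≡ ∣ p ∣
length-elements []            = refl
length-elements (inside  ∷ p) = cong suc (trans (length-map suc (elements p)) (length-elements p))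
length-elements (outside ∷ p) = trans (length-map suc (elements p)) (length-elements p)

∈-elements⁺ : ∀ {p : Subset n} {v} → v ∈ p → v ∈ₗ elements p
∈-elements⁺                   here      = here refl
∈-elements⁺ {p = inside  ∷ _} (there i) = there (∈-map⁺ suc (∈-elements⁺ i))
∈-elements⁺ {p = outside ∷ _} (there i) = ∈-map⁺ suc (∈-elements⁺ i)

∈-elements⁻ : ∀ (p : Subset n) {v} → v ∈ₗ elements p → v ∈ p
∈-elements⁻ (inside ∷ p) (here refl) = here
∈-elements⁻ (inside ∷ p) (there i) with ∈-map⁻ suc i
... | _ , j , refl = there (∈-elements⁻ p j)
∈-elements⁻ (outside ∷ p) i with ∈-map⁻ suc i
... | _ , j , refl = there (∈-elements⁻ p j)

elements-unique : (p : Subset n) → Unique (elements p)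
elements-unique []            = []
elements-unique (inside  ∷ p) =
  All.map⁺ (All.universal (λ _ ()) (elements p)) ∷ Unique.map⁺ Fin.suc-injective (elements-unique p)
elements-unique (outside ∷ p) = Unique.map⁺ Fin.suc-injective (elements-unique p)

fromList : List (Fin n) → Subset n
fromList = foldr (λ v p → ⁅ v ⁆ ∪ p) ∅

∈-fromList⁺ : ∀ {xs : List (Fin n)} {v} → v ∈ₗ xs → v ∈ fromList xs
∈-fromList⁺ (here refl) = x∈p∪q⁺ (inj₁ (x∈⁅x⁆ _))
∈-fromList⁺ (there i)   = x∈p∪q⁺ (inj₂ (∈-fromList⁺ i))

∈-fromList⁻ : ∀ (xs : List (Fin n)) {v} → v ∈ fromList xs → v ∈ₗ xs
∈-fromList⁻ []       i = contradiction i ∉⊥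
∈-fromList⁻ (x ∷ xs) i with x∈p∪q⁻ ⁅ x ⁆ (fromList xs) i
... | inj₁ j = here (x∈⁅y⁆⇒x≡y x j)
... | inj₂ j = there (∈-fromList⁻ xs j)

∣p∪q∣≤∣p∣+∣q∣ : (p q : Subset n) → ∣ p ∪ q ∣ ≤ ∣ p ∣ + ∣ q ∣
∣p∪q∣≤∣p∣+∣q∣ []            []            = z≤n
∣p∪q∣≤∣p∣+∣q∣ (inside  ∷ p) (inside  ∷ q) =
  s≤s (≤-trans (∣p∪q∣≤∣p∣+∣q∣ p q) (+-monoʳ-≤ ∣ p ∣ (n≤1+n ∣ q ∣)))
∣p∪q∣≤∣p∣+∣q∣ (inside  ∷ p) (outside ∷ q) = s≤s (∣p∪q∣≤∣p∣+∣q∣ p q)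
∣p∪q∣≤∣p∣+∣q∣ (outside ∷ p) (inside  ∷ q) =
  subst (suc ∣ p ∪ q ∣ ≤_) (sym (+-suc ∣ p ∣ ∣ q ∣)) (s≤s (∣p∪q∣≤∣p∣+∣q∣ p q))
∣p∪q∣≤∣p∣+∣q∣ (outside ∷ p) (outside ∷ q) = ∣p∪q∣≤∣p∣+∣q∣ p q

∣p∣≤∣q∣+∣p─q∣ : (p q : Subset n) → ∣ p ∣ ≤ ∣ q ∣ + ∣ p ─ q ∣
∣p∣≤∣q∣+∣p─q∣ []            []            = z≤n
∣p∣≤∣q∣+∣p─q∣ (inside  ∷ p) (inside  ∷ q) = s≤s (∣p∣≤∣q∣+∣p─q∣ p q)
∣p∣≤∣q∣+∣p─q∣ (outside ∷ p) (inside  ∷ q) = m≤n⇒m≤1+n (∣p∣≤∣q∣+∣p─q∣ p q)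
∣p∣≤∣q∣+∣p─q∣ (inside  ∷ p) (outside ∷ q) =
  subst (suc ∣ p ∣ ≤_) (sym (+-suc ∣ q ∣ _)) (s≤s (∣p∣≤∣q∣+∣p─q∣ p q))
∣p∣≤∣q∣+∣p─q∣ (outside ∷ p) (outside ∷ q) = ∣p∣≤∣q∣+∣p─q∣ p q

x∈p─q⇒x∉q : ∀ (p q : Subset n) {v} → v ∈ p ─ q → v ∉ q
x∈p─q⇒x∉q (_ ∷ p) (outside ∷ q) here      ()
x∈p─q⇒x∉q (_ ∷ p) (_       ∷ q) (there i) (there j) = x∈p─q⇒x∉q p q i j

∣fromList∣≤length : (xs : List (Fin n)) → ∣ fromList xs ∣ ≤ length xs
∣fromList∣≤length {n} []       = ≤-reflexive (∣⊥∣≡0 n)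
∣fromList∣≤length     (x ∷ xs) = begin
  ∣ ⁅ x ⁆ ∪ fromList xs ∣       ≤⟨ ∣p∪q∣≤∣p∣+∣q∣ ⁅ x ⁆ (fromList xs) ⟩
  ∣ ⁅ x ⁆ ∣ + ∣ fromList xs ∣   ≡⟨ cong (_+ ∣ fromList xs ∣) (∣⁅x⁆∣≡1 x) ⟩
  suc ∣ fromList xs ∣           ≤⟨ s≤s (∣fromList∣≤length xs) ⟩
  suc (length xs)               ∎
  where open ≤-Reasoning

unique⇒length≤ : ∀ {xs : List (Fin n)} {p} → Unique xs → (∀ {v} → v ∈ₗ xs → v ∈ p) → length xs ≤ ∣ p ∣
unique⇒length≤ []          xs⊆p = z≤n
unique⇒length≤ (x∉xs ∷ u) xs⊆p =
  ≤-<-trans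
    (unique⇒length≤ u λ i → x∈p∧x≢y⇒x∈p-y (xs⊆p (there i)) (λ v≡x → All.lookup x∉xs i (sym v≡x)))
    (x∈p⇒∣p-x∣<∣p∣ (xs⊆p (here refl)))

-- Turns a repetition-free list into an injection of `Fin k`, the form in which `HasInduced` asks
-- for the sides of a biclique.
unique⇒enumeration : ∀ {xs : List A} {k} → Unique xs → k ≤ length xs →
  Σ (Fin k → A) λ f → Injective _≡_ _≡_ f × (∀ i → f i ∈ₗ xs)
unique⇒enumeration {xs = xs} u k≤ =
  (λ i → List.lookup xs (inject≤ i k≤)) ,
  (λ eq → inject≤-injective k≤ k≤ _ _ (lookup-injective u eq)) ,
  (λ i → ∈-lookup _)
  where
  lookup-injective : ∀ {xs : List A} → Unique xs → ∀ {i j} → List.lookup xs i ≡ List.lookup xs j → i ≡ j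
  lookup-injective (_ ∷ u)    {zero}  {zero}  eq = refl
  lookup-injective (x∉ ∷ u) {zero}  {suc j} eq = contradiction eq (All.lookup x∉ (∈-lookup j))
  lookup-injective (x∉ ∷ u) {suc i} {zero}  eq = contradiction (sym eq) (All.lookup x∉ (∈-lookup i))
  lookup-injective (_ ∷ u)    {suc i} {suc j} eq = cong suc (lookup-injective u eq)

module _ (_≟ᴮ_ : DecidableEquality B) (f : A → B) where

  fibre : B → List A → List A
  fibre y = filter (λ x → f x ≟ᴮ y)

  private
    other : B → List A → List A
    other y = filter (λ x → ¬? (f x ≟ᴮ y))

    length-split : ∀ y xs → length xs ≡ length (fibre y xs) + length (other y xs)
    length-split y []       = refl
    length-split y (x ∷ xs) with f x ≟ᴮ y
    ... | yes _ = cong suc (length-split y xs)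
    ... | no  _ = trans (cong suc (length-split y xs)) (sym (+-suc (length (fibre y xs)) _))

    length-fibre-other : ∀ y z xs → length (fibre z (other y xs)) ≤ length (fibre z xs)
    length-fibre-other y z []       = z≤n
    length-fibre-other y z (x ∷ xs) with f x ≟ᴮ y
    ... | yes _ with f x ≟ᴮ z
    ...   | yes _ = m≤n⇒m≤1+n (length-fibre-other y z xs)
    ...   | no  _ = length-fibre-other y z xs
    length-fibre-other y z (x ∷ xs) | no _ with f x ≟ᴮ z
    ...   | yes _ = s≤s (length-fibre-other y z xs)
    ...   | no  _ = length-fibre-other y z xs

  -- One value y is split off at a time: its fibre has at most k members, and the remaining elements
  -- take values in the rest of `ys`. Removing elements can only shrink the other fibres, which
  -- keeps the hypothesis alive.
  pigeonhole : ∀ k xs ys → (∀ {x} → x ∈ₗ xs → f x ∈ₗ ys) →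
    (∀ y → length (fibre y xs) ≤ k) → length xs ≤ length ys * k
  pigeonhole k []       []       _   _ = z≤n
  pigeonhole k (x ∷ xs) []       f∈ys _ with () ← f∈ys (here refl)
  pigeonhole k xs       (y ∷ ys) f∈ys small = begin
    length xs                                ≡⟨ length-split y xs ⟩
    length (fibre y xs) + length (other y xs) ≤⟨ +-mono-≤ (small y) rest ⟩
    k + length ys * k                        ∎
    where
    open ≤-Reasoning
    tail : ∀ {x} → x ∈ₗ other y xs → f x ∈ₗ ys
    tail i with ∈-filter⁻ (λ x → ¬? (f x ≟ᴮ y)) i
    ... | j , fx≢y with f∈ys j
    ...   | here fx≡y = contradiction fx≡y fx≢y
    ...   | there l   = l
    rest = pigeonhole k (other y xs) ys tail
             (λ z → ≤-trans (length-fibre-other y z xs) (small z))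

length-cartesianProductWith : ∀ {C : Set} (f : A → B → C) xs ys →
  length (cartesianProductWith f xs ys) ≡ length xs * length ys
length-cartesianProductWith f []       ys = refl
length-cartesianProductWith f (x ∷ xs) ys =
  trans (length-++ (map (f x) ys))
        (cong₂ _+_ (length-map (f x) ys) (length-cartesianProductWith f xs ys))

-- The approximation ratio

listsUpTo : ℕ → List A → List (List A)
listsUpTo zero    xs = [] ∷ []
listsUpTo (suc k) xs = [] ∷ cartesianProductWith _∷_ xs (listsUpTo k xs)

∈-listsUpTo : ∀ k {xs} (zs : List A) → (∀ {z} → z ∈ₗ zs → z ∈ₗ xs) → take k zs ∈ₗ listsUpTo k xs
∈-listsUpTo zero    zs       zs⊆xs = here refl
∈-listsUpTo (suc k) []       zs⊆xs = here refl
∈-listsUpTo (suc k) (z ∷ zs) zs⊆xs =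
  there (∈-cartesianProductWith⁺ _∷_ (zs⊆xs (here refl)) (∈-listsUpTo k zs (zs⊆xs ∘ there)))

-- A list of length at most k is a word of length k over `xs` with one extra padding letter, hence
-- the base `suc (length xs)`.
length-listsUpTo : ∀ k (xs : List A) → length (listsUpTo k xs) ≤ suc (length xs) ^ k
length-listsUpTo zero    xs = ≤-refl
length-listsUpTo (suc k) xs = begin
  suc (length (cartesianProductWith _∷_ xs (listsUpTo k xs)))
    ≡⟨ cong suc (length-cartesianProductWith _∷_ xs (listsUpTo k xs)) ⟩
  suc (length xs * length (listsUpTo k xs))
    ≤⟨ +-mono-≤ (m^n>0 (suc (length xs)) k) (*-monoʳ-≤ (length xs) (length-listsUpTo k xs)) ⟩
  suc (length xs) ^ k + length xs * suc (length xs) ^ k ∎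
  where open ≤-Reasoning

takeAll⁻ : ∀ k (xs : List A) → length (take k xs) < k → take k xs ≡ xs
takeAll⁻ (suc k) []       _       = refl
takeAll⁻ (suc k) (x ∷ xs) (s≤s p) = cong (x ∷_) (takeAll⁻ k xs p)

module _ {t : ℕ} (G : Graph (Fin n)) (noK : ¬ HasInduced G (K t t))
         {S I : Subset n} (S-ind : Independent G S) (S-opt : LocallyOptimal t G S)
         (I-ind : Independent G I) where

  private
    adjacent? : ∀ u v → Dec (adj G u v ≡ true)
    adjacent? u v = adj G u v Bool.≟ true

    neighbours : Fin n → List (Fin n)
    neighbours v = filter (adjacent? v) (elements S)

    -- Truncation at t serves two ends: t entries are exactly one side of `K t t`, and the cap keeps
    -- the number of codes polynomial in |S| of degree t.
    code : Fin n → List (Fin n)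
    code v = take t (neighbours v)

    code⊆neighbours : ∀ {u} v → u ∈ₗ code v → u ∈ S × adj G v u ≡ true
    code⊆neighbours v i with ∈-filter⁻ (adjacent? v) (∈-take t (neighbours v) i)
      where
      ∈-take : ∀ k (xs : List A) {x} → x ∈ₗ take k xs → x ∈ₗ xs
      ∈-take (suc k) (_ ∷ xs) (here e)  = here e
      ∈-take (suc k) (_ ∷ xs) (there i) = there (∈-take k xs i)
    ... | j , a = ∈-elements⁻ S j , a

    code-unique : ∀ v → Unique (code v)
    code-unique v = Unique.take⁺ t (Unique.filter⁺ (adjacent? v) (elements-unique S))

    _≟ₗ_ : DecidableEquality (List (Fin n))
    _≟ₗ_ = ≡-dec Fin._≟_

    ys : List (Fin n)
    ys = elements (I ─ S)

    module _ (y : List (Fin n)) where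

      F : List (Fin n)
      F = fibre _≟ₗ_ code y ys

      F⊆ : ∀ {v} → v ∈ₗ F → v ∈ I × v ∉ S × code v ≡ y
      F⊆ i with ∈-filter⁻ (λ v → code v ≟ₗ y) i
      ... | j , c = p─q⊆p I S (∈-elements⁻ _ j) , x∈p─q⇒x∉q I S (∈-elements⁻ _ j) , c

      F-unique : Unique F
      F-unique = Unique.filter⁺ (λ v → code v ≟ₗ y) (elements-unique (I ─ S))

      F-independent : ∀ {u v} → u ∈ₗ F → v ∈ₗ F → adj G u v ≡ false
      F-independent i j = I-ind (proj₁ (F⊆ i)) (proj₁ (F⊆ j))

      y⊆ : ∀ {u v} → v ∈ₗ F → u ∈ₗ y → u ∈ S × adj G v u ≡ true
      y⊆ {v = v} v∈F u∈y with F⊆ v∈F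
      ... | _ , _ , refl = code⊆neighbours v u∈y

      -- One side is drawn from y inside `S`, the other from the fibre inside `I` and outside `S`.
      -- Independence of `S` and `I` makes the biclique induced; all cross edges exist because y is
      -- the code of every vertex of the fibre.
      biclique : ∀ {v} → v ∈ₗ F → t ≤ length y → t ≤ length F → HasInduced G (K t t)
      biclique {v} v∈F t≤y t≤F with F⊆ v∈F
      ... | _ , _ , refl
        with unique⇒enumeration (code-unique v) t≤y | unique⇒enumeration F-unique t≤F
      ... | f , f-inj , f∈ | g , g-inj , g∈ = h , h-inj , h-adj
        where
        f∈S : ∀ i → f i ∈ S
        f∈S i = proj₁ (y⊆ v∈F (f∈ i))

        f≢g : ∀ i j → f i ≢ g j
        f≢g i j eq = proj₁ (proj₂ (F⊆ (g∈ j))) (subst (_∈ S) eq (f∈S i))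

        h : Fin t ⊎ Fin t → Fin n
        h (inj₁ i) = f i
        h (inj₂ j) = g j

        h-inj : Injective _≡_ _≡_ h
        h-inj {inj₁ i} {inj₁ j} eq = cong inj₁ (f-inj eq)
        h-inj {inj₁ i} {inj₂ j} eq = contradiction eq (f≢g i j)
        h-inj {inj₂ i} {inj₁ j} eq = contradiction (sym eq) (f≢g j i)
        h-inj {inj₂ i} {inj₂ j} eq = cong inj₂ (g-inj eq)

        h-adj : ∀ a b → adj G (h a) (h b) ≡ adj (K t t) a b
        h-adj (inj₁ i) (inj₁ j) = S-ind (f∈S i) (f∈S j)
        h-adj (inj₁ i) (inj₂ j) = trans (symmetric G _ _) (proj₂ (y⊆ (g∈ j) (f∈ i)))
        h-adj (inj₂ i) (inj₁ j) = proj₂ (y⊆ (g∈ i) (f∈ j))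
        h-adj (inj₂ i) (inj₂ j) = F-independent (g∈ i) (g∈ j)

      -- A short code is the whole neighbourhood in S, so y can be exchanged for |y| + 1 vertices
      -- of its fibre.
      exchangeable : length y < t → length y < length F → ∃[ S′ ] Improvement t G S S′
      exchangeable y<t y<F = (S ─ X) ∪ Y , record
        { X           = X
        ; Y           = Y
        ; X⊆S         = X⊆S
        ; Y⊆V∖S       = λ i → x∉p⇒x∈∁p (proj₁ (proj₂ (F⊆ (Y⊆F i))))
        -- |X| is at most |y|, while `Z`, repetition-free of length |y| + 1, gives |Y| at least |y|
        -- + 1.
        ; ∣X∣<∣Y∣     = ≤-<-trans (∣fromList∣≤length y)
                          (≤-trans (≤-reflexive (sym length-Z)) (unique⇒length≤ Z-unique ∈-fromList⁺))
        ; ∣Y∣≤t       = ≤-trans (∣fromList∣≤length Z) (≤-trans (≤-reflexive length-Z) y<t)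
        ; exchange    = refl
        ; independent = λ i j → independent (x∈p∪q⁻ _ _ i) (x∈p∪q⁻ _ _ j)
        }
        where
        Z = take (suc (length y)) F
        X = fromList y
        Y = fromList Z

        length-Z : length Z ≡ suc (length y)
        length-Z = trans (length-take _ F) (m≤n⇒m⊓n≡m y<F)

        Z-unique : Unique Z
        Z-unique = Unique.take⁺ _ F-unique

        Y⊆F : ∀ {v} → v ∈ Y → v ∈ₗ F
        Y⊆F i = All.lookup (All.take⁺ (suc (length y)) (All.tabulate λ j → j)) (∈-fromList⁻ Z i)

        X⊆S : X ⊆ S
        -- y lies in `S` because it is the code of some vertex; `y<F` makes the fibre nonempty and
        -- so supplies one.
        X⊆S i = proj₁ (y⊆ (∈-lookup {xs = F} (fromℕ< (≤-<-trans z≤n y<F))) (∈-fromList⁻ y i))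

        cross : ∀ {u v} → u ∈ S ─ X → v ∈ Y → adj G v u ≡ false
        -- A neighbour u of v in `S` would occur in `neighbours v`, which is y, and so would have
        -- been removed with `X`.
        cross {u} {v} i j = Bool.¬-not λ a →
          x∈p─q⇒x∉q S X i (∈-fromList⁺
            (subst (u ∈ₗ_) neighbours≡y (∈-filter⁺ (adjacent? v) (∈-elements⁺ (p─q⊆p S X i)) a)))
          where
          c = proj₂ (proj₂ (F⊆ (Y⊆F j)))
          neighbours≡y : neighbours v ≡ y
          neighbours≡y = trans
            (sym (takeAll⁻ t _ (subst (λ z → length z < t) (sym c) y<t))) c

        independent : ∀ {u v} → u ∈ S ─ X ⊎ u ∈ Y → v ∈ S ─ X ⊎ v ∈ Y → adj G u v ≡ false
        independent (inj₁ i) (inj₁ j) = S-ind (p─q⊆p S X i) (p─q⊆p S X j)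
        independent (inj₁ i) (inj₂ j) = trans (symmetric G _ _) (cross i j)
        independent (inj₂ i) (inj₁ j) = cross j i
        independent (inj₂ i) (inj₂ j) = F-independent (Y⊆F i) (Y⊆F j)

      small : length F ≤ t
      small with length F ≤? t
      ... | yes p = p
      ... | no ¬p with t ≤? length y
      ...   | yes t≤y = contradiction
                (biclique (∈-lookup {xs = F} (fromℕ< (≤-<-trans z≤n (≰⇒> ¬p)))) t≤y (<⇒≤ (≰⇒> ¬p)))
                noK
      ...   | no t≰y  = contradiction (exchangeable (≰⇒> t≰y) (<-trans (≰⇒> t≰y) (≰⇒> ¬p))) S-opt

  independent-set-bound : ∣ I ∣ ≤ ∣ S ∣ + suc ∣ S ∣ ^ t * t
  independent-set-bound = begin
    ∣ I ∣                                ≤⟨ ∣p∣≤∣q∣+∣p─q∣ I S ⟩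
    ∣ S ∣ + ∣ I ─ S ∣                    ≡⟨ cong (∣ S ∣ +_) (sym (length-elements (I ─ S))) ⟩
    ∣ S ∣ + length ys                    ≤⟨ +-monoʳ-≤ ∣ S ∣ (pigeonhole _≟ₗ_ code t ys codes code∈codes small) ⟩
    ∣ S ∣ + length codes * t             ≤⟨ +-monoʳ-≤ ∣ S ∣ (*-monoˡ-≤ t (length-listsUpTo t (elements S))) ⟩
    ∣ S ∣ + suc (length (elements S)) ^ t * t
      ≡⟨ cong (λ m → ∣ S ∣ + suc m ^ t * t) (length-elements S) ⟩
    ∣ S ∣ + suc ∣ S ∣ ^ t * t            ∎
    where
    open ≤-Reasoning
    codes = listsUpTo t (elements S)
    code∈codes : ∀ {v} → v ∈ₗ ys → code v ∈ₗ codes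
    code∈codes {v} _ = ∈-listsUpTo t (neighbours v) (λ i → proj₁ (∈-filter⁻ (adjacent? v) i))

-- Growth and independence along improvements

module _ {t : ℕ} {G : Graph (Fin n)} where
  open Improvement

  -- The identity |S′| + |X| = |S| + |Y| avoids truncated subtraction; it is checked coordinate by
  -- coordinate, as `X` lies in `S` and `Y` misses `S`. Growth bounds the number of rounds and keeps
  -- the output nonempty.
  Improvement-grows : ∀ {S S′} → Improvement t G S S′ → ∣ S ∣ < ∣ S′ ∣
  Improvement-grows {S} {S′} imp = +-cancelʳ-< _ ∣ S ∣ ∣ S′ ∣ (begin-strict
    ∣ S ∣ + ∣ X imp ∣   <⟨ +-monoʳ-< ∣ S ∣ (∣X∣<∣Y∣ imp) ⟩
    ∣ S ∣ + ∣ Y imp ∣   ≡⟨ sym (count S (X imp) (Y imp) (X⊆S imp) (λ i → x∈∁p⇒x∉p (Y⊆V∖S imp i))) ⟩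
    ∣ (S ─ X imp) ∪ Y imp ∣ + ∣ X imp ∣ ≡⟨ cong (λ T → ∣ T ∣ + ∣ X imp ∣) (sym (exchange imp)) ⟩
    ∣ S′ ∣ + ∣ X imp ∣  ∎)
    where
    open ≤-Reasoning
    count : ∀ {m} (S X Y : Subset m) → X ⊆ S → (∀ {v} → v ∈ Y → v ∉ S) →
      ∣ (S ─ X) ∪ Y ∣ + ∣ X ∣ ≡ ∣ S ∣ + ∣ Y ∣
    count [] [] [] _ _ = refl
    count (s ∷ S) (x ∷ X) (y ∷ Y) X⊆S Y#S
      with count S X Y (λ i → drop-there (X⊆S (there i))) (λ i j → Y#S (there i) (there j))
      where
      drop-there : ∀ {m} {v : Fin m} {p s} → suc v ∈ s ∷ p → v ∈ p
      drop-there (there i) = i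
    count (outside ∷ S) (outside ∷ X) (outside ∷ Y) _ _ | eq = eq
    count (outside ∷ S) (outside ∷ X) (inside ∷ Y) _ _ | eq = trans (cong suc eq) (sym (+-suc ∣ S ∣ ∣ Y ∣))
    count (outside ∷ S) (inside ∷ X) (_ ∷ Y) X⊆S _ | eq with () ← X⊆S here
    count (inside ∷ S) (_ ∷ X) (inside ∷ Y) _ Y#S | eq = contradiction here (Y#S here)
    count (inside ∷ S) (outside ∷ X) (outside ∷ Y) _ _ | eq = cong suc eq
    count (inside ∷ S) (inside ∷ X) (outside ∷ Y) _ _ | eq =
      trans (+-suc _ ∣ X ∣) (cong suc eq)

  Star-grows : ∀ {S S′} → Star (Improvement t G) S S′ → ∣ S ∣ ≤ ∣ S′ ∣
  Star-grows ε          = ≤-refl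
  Star-grows (imp ◅ st) = ≤-trans (<⇒≤ (Improvement-grows imp)) (Star-grows st)

  Star-independent : ∀ {S S′} → Independent G S → Star (Improvement t G) S S′ → Independent G S′
  Star-independent ind ε          = ind
  Star-independent ind (imp ◅ st) = Star-independent (independent imp) st

singleton-independent : (G : Graph (Fin n)) (v : Fin n) → Independent G ⁅ v ⁆
singleton-independent G v i j with x∈⁅y⁆⇒x≡y v i | x∈⁅y⁆⇒x≡y v j
... | refl | refl = irreflexive G v

-- From the counting bound to the ratio

^-distribʳ-* : ∀ k m o → (m * o) ^ k ≡ m ^ k * o ^ k
^-distribʳ-* zero    m o = refl
^-distribʳ-* (suc k) m o =
  trans (cong (m * o *_) (^-distribʳ-* k m o))
        (CommutativeSemigroup.interchange *-commutativeSemigroup m o (m ^ k) (o ^ k))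

-- For m at least 1, 1 + m is at most 2m, so (1 + m)^t is at most 2^t m^t, and m^t absorbs the
-- linear term. This is the origin of the constant 1 + 2^t t.
polynomial-bound : ∀ t m → 1 ≤ t → 1 ≤ m → m + suc m ^ t * t ≤ (1 + 2 ^ t * t) * m ^ t
polynomial-bound t@(suc t-1) m@(suc m-1) _ 1≤m = begin
  m + suc m ^ t * t           ≤⟨ +-mono-≤ (m≤m*n m (m ^ t-1) {{m^n≢0 m t-1}}) (*-monoˡ-≤ t (^-monoˡ-≤ t 1+m≤2m)) ⟩
  m ^ t + (2 * m) ^ t * t     ≡⟨ cong (λ z → m ^ t + z * t) (^-distribʳ-* t 2 m) ⟩
  m ^ t + 2 ^ t * m ^ t * t   ≡⟨ cong (m ^ t +_) (trans (*-assoc (2 ^ t) _ _)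
                                   (trans (cong (2 ^ t *_) (*-comm (m ^ t) t)) (sym (*-assoc (2 ^ t) t _)))) ⟩
  (1 + 2 ^ t * t) * m ^ t     ∎
  where
  open ≤-Reasoning
  1+m≤2m : suc m ≤ 2 * m
  1+m≤2m = subst (suc m ≤_) (cong (m +_) (sym (+-identityʳ m))) (+-monoˡ-≤ m 1≤m)

-- One of the t factors a is traded for C m^t; as C is at least 1, C may then grow to C^t.
withinRatio : ∀ t C a m → 1 ≤ t → 1 ≤ C → a ≤ C * m ^ t → WithinRatio t C a m
withinRatio (suc k) C@(suc _) a m _ _ a≤ = begin
  a * a ^ k                         ≤⟨ *-monoˡ-≤ (a ^ k) a≤ ⟩
  C * m ^ suc k * a ^ k             ≤⟨ *-monoˡ-≤ (a ^ k) (*-monoˡ-≤ (m ^ suc k) (m≤m*n C (C ^ k) {{m^n≢0 C k}})) ⟩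
  C ^ suc k * m ^ suc k * a ^ k     ≡⟨ *-assoc (C ^ suc k) _ _ ⟩
  C ^ suc k * (m ^ suc k * a ^ k)   ≡⟨ cong (C ^ suc k *_) (*-comm (m ^ suc k) (a ^ k)) ⟩
  C ^ suc k * (a ^ k * m ^ suc k)   ≡⟨ sym (*-assoc (C ^ suc k) _ _) ⟩
  C ^ suc k * a ^ k * m ^ suc k     ∎
  where open ≤-Reasoning

approximatesMIS : ∀ t → 1 ≤ t → ApproximatesMIS t
approximatesMIS t 1≤t = 1 + 2 ^ t * t , bound
  where
  bound : ∀ {n} (G : Graph (Fin n)) → ¬ HasInduced G (K t t) →
    ∀ S → Output t G S → ∀ opt → IsOPT G opt →
    Independent G S × WithinRatio t (1 + 2 ^ t * t) opt ∣ S ∣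
  bound G noK S (v , path , S-opt) _ ((I , I-ind , refl) , _) =
    S-ind , withinRatio t (1 + 2 ^ t * t) ∣ I ∣ ∣ S ∣ 1≤t (s≤s z≤n)
      (≤-trans (independent-set-bound G noK S-ind S-opt I-ind)
               -- The search starts from a singleton and never shrinks, so |S| is at least 1.
               (polynomial-bound t ∣ S ∣ 1≤t (≤-trans (≤-reflexive (sym (∣⁅x⁆∣≡1 v))) (Star-grows path))))
    where
    S-ind : Independent G S
    S-ind = Star-independent (singleton-independent G v) path

-- Structured programs

n≡ᵇn : ∀ k → (k ≡ᵇ k) ≡ true
n≡ᵇn zero    = refl
n≡ᵇn (suc k) = n≡ᵇn k

≡⇒≡ᵇ-true : ∀ {k l} → k ≡ l → (k ≡ᵇ l) ≡ true
≡⇒≡ᵇ-true {k} refl = n≡ᵇn k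

≢⇒≡ᵇ-false : ∀ {k l} → k ≢ l → (k ≡ᵇ l) ≡ false
≢⇒≡ᵇ-false {k} {l} k≢l = Bool.¬-not λ eq → k≢l (≡ᵇ⇒≡ k l (subst T (sym eq) tt))

>⇒≡ᵇ-false : ∀ {k l} → l < k → (k ≡ᵇ l) ≡ false
>⇒≡ᵇ-false = ≢⇒≡ᵇ-false ∘ >⇒≢

+-≡ᵇ-cancelˡ : ∀ o k l → (o + k ≡ᵇ o + l) ≡ (k ≡ᵇ l)
+-≡ᵇ-cancelˡ zero    k l = refl
+-≡ᵇ-cancelˡ (suc o) k l = +-≡ᵇ-cancelˡ o k l

test one : Reg
test = 3
one  = 4

infixr 5 _▸_

-- Only counted loops are available. Under the side conditions of `exec`, a program therefore halts,
-- acts as a function on states, and has a time bound depending on n alone.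
data Prog : Set where
  nop    : Prog
  set    : Reg → Expr → Prog
  store  : Reg → Reg → Prog
  pick   : Reg → Reg → Prog
  _▸_    : Prog → Prog → Prog
  branch : Reg → Prog → Prog → Prog
  for    : Reg → Prog → Prog

compile : Prog → Cmd
compile nop            = skip
compile (set x e)      = x ≔ e
compile (store x y)    = mem[ x ]≔ y
compile (pick x y)     = choose x y
compile (p ▸ q)        = compile p ⨾ compile q
compile (branch x p q) = cond x (compile p) (compile q)
-- `test` holds `order` minus the counter, hence vanishes exactly after the last round.
compile (for i p)      =
  i ≔ const 0 ⨾ test ≔ (order ⊖ i) ⨾
  while test (compile p ⨾ one ≔ const 1 ⨾ i ≔ (i ⊕ one) ⨾ test ≔ (order ⊖ i))

-- A branch pays for both alternatives, which makes the bound independent of the state. A loop pays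
-- 2 for its initialisation, 1 for each test, and 3 per round besides its body.
cost : ℕ → Prog → ℕ
cost n nop            = 1
cost n (set x e)      = 1
cost n (store x y)    = 1
cost n (pick x y)     = 1
cost n (p ▸ q)        = cost n p + cost n q
cost n (branch x p q) = suc (cost n p + cost n q)
cost n (for i p)      = 2 + (n * suc (cost n p + 3) + 1)

assigns : Prog → Reg → Bool
assigns nop            r = false
assigns (set x e)      r = r ≡ᵇ x
assigns (store x y)    r = false
assigns (pick x y)     r = r ≡ᵇ x
assigns (p ▸ q)        r = assigns p r ∨ assigns q r
assigns (branch x p q) r = assigns p r ∨ assigns q r
assigns (for i p)      r = (r ≡ᵇ i) ∨ (r ≡ᵇ test) ∨ (r ≡ᵇ one) ∨ assigns p r

-- The counter must survive the body. The registers `test` and `one` may be overwritten there, since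
-- every round reloads them; so nested loops can share them.
LoopSafe : Prog → Set
LoopSafe (p ▸ q)        = LoopSafe p × LoopSafe q
LoopSafe (branch x p q) = LoopSafe p × LoopSafe q
LoopSafe (for i p)      =
  (i ≡ᵇ test) ≡ false × (i ≡ᵇ one) ≡ false × assigns p i ≡ false × LoopSafe p
LoopSafe _              = ⊤

∨-falseˡ : ∀ {a b} → a ∨ b ≡ false → a ≡ false
∨-falseˡ = Bool.∨-conicalˡ _ _

∨-falseʳ : ∀ {a b} → a ∨ b ≡ false → b ≡ false
∨-falseʳ {a} = Bool.∨-conicalʳ a _

repeat : ℕ → (State → State) → State → State
repeat zero    f s = s
repeat (suc k) f s = repeat k f (f s)

ifNonzero : ℕ → State → State → State
ifNonzero zero    s s′ = s′
ifNonzero (suc _) s s′ = s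

module Semantics {n} (G : Graph (Fin n)) where

  setTo : Reg → Expr → State → State
  setTo x e s = setReg x (eval G e s) s

  start-loop : Reg → State → State
  start-loop i s = setTo test (order ⊖ i) (setTo i (const 0) s)

  advance : Reg → State → State
  advance i s = setTo test (order ⊖ i) (setTo i (i ⊕ one) (setTo one (const 1) s))

  ⟦_⟧ : Prog → State → State
  ⟦ nop ⟧          s = s
  ⟦ set x e ⟧      s = setTo x e s
  ⟦ store x y ⟧    s = record s { mem = mem s [ reg s x ↦ reg s y ] }
  ⟦ pick x y ⟧     s = setReg x (tape s 0 ⊓ reg s y) (record s { tape = λ i → tape s (suc i) })
  ⟦ p ▸ q ⟧        s = ⟦ q ⟧ (⟦ p ⟧ s)
  ⟦ branch x p q ⟧ s = ifNonzero (reg s x) (⟦ p ⟧ s) (⟦ q ⟧ s)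
  -- The number of repetitions is n rather than the content of `order`; `exec` matches this with the
  -- machine by assuming that `order` holds n and is never assigned.
  ⟦ for i p ⟧      s = repeat n (λ s → advance i (⟦ p ⟧ s)) (start-loop i s)

  setReg-other : ∀ {x r} a s → (r ≡ᵇ x) ≡ false → reg (setReg x a s) r ≡ reg s r
  setReg-other a s eq rewrite eq = refl

  start-loop-other : ∀ i r s → (r ≡ᵇ i) ≡ false → (r ≡ᵇ test) ≡ false →
    reg (start-loop i s) r ≡ reg s r
  start-loop-other i r s r≢i r≢test rewrite r≢test | r≢i = refl

  advance-other : ∀ i r s → (r ≡ᵇ i) ≡ false → (r ≡ᵇ test) ≡ false → (r ≡ᵇ one) ≡ false →
    reg (advance i s) r ≡ reg s r
  advance-other i r s r≢i r≢test r≢one rewrite r≢test | r≢i | r≢one = refl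

  -- `assigns` computes a syntactic over-approximation of the registers written, so for concrete
  -- programs the premise holds by `refl`.
  frame : ∀ p r s → assigns p r ≡ false → reg (⟦ p ⟧ s) r ≡ reg s r
  frame nop            r s eq = refl
  frame (set x e)      r s eq = setReg-other (eval G e s) s eq
  frame (store x y)    r s eq = refl
  frame (pick x y)     r s eq = setReg-other (tape s 0 ⊓ reg s y) s eq
  frame (p ▸ q)        r s eq =
    trans (frame q r (⟦ p ⟧ s) (∨-falseʳ eq)) (frame p r s (∨-falseˡ eq))
  frame (branch x p q) r s eq with reg s x
  ... | zero  = frame q r s (∨-falseʳ eq)
  ... | suc _ = frame p r s (∨-falseˡ eq)
  frame (for i p)      r s eq =
    trans (loop n (start-loop i s)) (start-loop-other i r s r≢i r≢test)
    where
    r≢i    = ∨-falseˡ {r ≡ᵇ i} eq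
    r≢test = ∨-falseˡ {r ≡ᵇ test} (∨-falseʳ {r ≡ᵇ i} eq)
    tail   = ∨-falseʳ {r ≡ᵇ test} (∨-falseʳ {r ≡ᵇ i} eq)
    loop : ∀ k s → reg (repeat k (λ s → advance i (⟦ p ⟧ s)) s) r ≡ reg s r
    loop zero    s = refl
    loop (suc k) s = trans (loop k (advance i (⟦ p ⟧ s)))
      (trans (advance-other i r (⟦ p ⟧ s) r≢i r≢test (∨-falseˡ {r ≡ᵇ one} tail))
             (frame p r s (∨-falseʳ {r ≡ᵇ one} tail)))

  module Loop (i : Reg) (p : Prog) (i≢test : (i ≡ᵇ test) ≡ false) (i≢one : (i ≡ᵇ one) ≡ false)
              (p-keeps-i : assigns p i ≡ false)
              (keeps-order : assigns (for i p) order ≡ false) where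

    private
      order≢i : (order ≡ᵇ i) ≡ false
      order≢i = ∨-falseˡ keeps-order

      p-keeps-order : assigns p order ≡ false
      p-keeps-order = ∨-falseʳ {order ≡ᵇ i} keeps-order

    body : State → State
    body s = advance i (⟦ p ⟧ s)

    body-order : ∀ s → reg (body s) order ≡ reg s order
    body-order s = trans (advance-other i order (⟦ p ⟧ s) order≢i refl refl) (frame p order s p-keeps-order)

    body-counter : ∀ s → reg (body s) i ≡ suc (reg s i)
    body-counter s rewrite i≢test | n≡ᵇn i | i≢one =
      trans (+-comm _ 1) (cong suc (frame p i s p-keeps-i))

    start-counter : ∀ s → reg (start-loop i s) i ≡ 0
    start-counter s rewrite i≢test | n≡ᵇn i = refl

    start-order : ∀ s → reg (start-loop i s) order ≡ reg s order
    start-order s = start-loop-other i order s order≢i refl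

    test-start : ∀ s → reg (start-loop i s) test ≡ reg (start-loop i s) order ∸ reg (start-loop i s) i
    test-start s rewrite i≢test = refl

    test-body : ∀ s → reg (body s) test ≡ reg (body s) order ∸ reg (body s) i
    test-body s rewrite i≢test = refl

    -- The loop rule: the invariant is indexed by the counter value. The inner recursion carries the
    -- number k of rounds left, with j + k equal to n.
    invariant : (I : ℕ → State → Set) →
      (∀ j s → j < n → reg s i ≡ j → reg s order ≡ n → I j s → I (suc j) (body s)) →
      ∀ s → reg s order ≡ n → I 0 (start-loop i s) → I n (⟦ for i p ⟧ s)
    invariant I step s s-order base =
      loop n 0 (start-loop i s) refl (start-counter s) (trans (start-order s) s-order) base
      where
      loop : ∀ k j s → j + k ≡ n → reg s i ≡ j → reg s order ≡ n → I j s → I n (repeat k body s)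
      loop zero    j s j+k≡n _ _ h =
        subst (λ m → I m s) (trans (sym (+-identityʳ j)) j+k≡n) h
      loop (suc k) j s j+k≡n i≡j o h =
        loop k (suc j) (body s) (trans (sym (+-suc j k)) j+k≡n)
          (trans (body-counter s) (cong suc i≡j)) (trans (body-order s) o)
          (step j s (subst (j <_) j+k≡n (m<m+n j (s≤s z≤n))) i≡j o h)

  exec : ∀ p → LoopSafe p → assigns p order ≡ false → ∀ s → reg s order ≡ n →
    ∃[ k ] (G ⊢⟨ compile p , s ⟩⇓⟨ ⟦ p ⟧ s , k ⟩ × k ≤ cost n p)
  exec nop            _ _ s _ = 1 , skip⇓ , ≤-refl
  exec (set x e)      _ _ s _ = 1 , ≔⇓ , ≤-refl
  exec (store x y)    _ _ s _ = 1 , mem⇓ , ≤-refl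
  exec (pick x y)     _ _ s _ = 1 , choose⇓ , ≤-refl
  exec (p ▸ q) (safe-p , safe-q) ko s o
    with exec p safe-p (∨-falseˡ ko) s o
       | exec q safe-q (∨-falseʳ ko) (⟦ p ⟧ s) (trans (frame p order s (∨-falseˡ ko)) o)
  ... | k , run , k≤ | l , run′ , l≤ = k + l , ⨾⇓ run run′ , +-mono-≤ k≤ l≤
  exec (branch x p q) (safe-p , safe-q) ko s o
    with reg s x in eq | exec p safe-p (∨-falseˡ ko) s o | exec q safe-q (∨-falseʳ ko) s o
  ... | zero  | _ | l , run , l≤ =
    suc l , cond-else⇓ eq run , s≤s (≤-trans l≤ (m≤n+m _ (cost n p)))
  ... | suc m | k , run , k≤ | _ =
    suc k , cond-then⇓ (λ eq′ → 1+n≢0 (trans (sym eq) eq′)) run , s≤s (≤-trans k≤ (m≤m+n _ (cost n q)))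
  exec (for i p) (i≢test , i≢one , p-keeps-i , safe) ko s o
    with loop n (start-loop i s) (cong (_+ n) (start-counter s)) (trans (start-order s) o)
           (trans (test-start s) (cong₂ _∸_ (trans (start-order s) o) (start-counter s)))
    where
    open Loop i p i≢test i≢one p-keeps-i ko
    -- m is the number of rounds left and equals `test`, so recursion on m follows the machine's own
    -- stopping test.
    loop : ∀ m s → reg s i + m ≡ n → reg s order ≡ n → reg s test ≡ m →
      ∃[ k ] (G ⊢⟨ while test (compile p ⨾ one ≔ const 1 ⨾ i ≔ (i ⊕ one) ⨾ test ≔ (order ⊖ i)) , s ⟩⇓⟨
                    repeat m body s , k ⟩ × k ≤ m * suc (cost n p + 3) + 1)
    loop zero    s _  _ t = 1 , while-stop⇓ t , ≤-refl
    loop (suc m) s im o t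
      with exec p safe (∨-falseʳ {order ≡ᵇ i} ko) s o
         | loop m (body s) im′ o′ t′
      where
      o′  = trans (body-order s) o
      im′ = trans (cong (_+ m) (body-counter s)) (trans (sym (+-suc (reg s i) m)) im)
      t′  = trans (test-body s)
              (trans (cong (_∸ reg (body s) i) (trans o′ (sym im′))) (m+n∸m≡n (reg (body s) i) m))
    ... | k , run , k≤ | l , run′ , l≤ =
      suc ((k + 3) + l) ,
      while-loop⇓ (λ t≡0 → 1+n≢0 (trans (sym t) t≡0)) (⨾⇓ run (⨾⇓ ≔⇓ (⨾⇓ ≔⇓ ≔⇓))) run′ ,
      s≤s (≤-trans (+-mono-≤ (+-monoˡ-≤ 3 k≤) l≤) (≤-reflexive (sym (+-assoc (cost n p + 3) _ 1))))
  ... | k , run , k≤ = 2 + k , ⨾⇓ ≔⇓ (⨾⇓ ≔⇓ run) , s≤s (s≤s k≤)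

-- Polynomial bounds

-- An input comes with a start vertex, so n is at least 1; powers of n are then monotone in the
-- exponent, and a sum can take the exponent d + d′.
Polynomial : (ℕ → ℕ) → Set
Polynomial f = ∃[ c ] ∃[ d ] (∀ n → 1 ≤ n → f n ≤ c * n ^ d)

const-polynomial : ∀ k → Polynomial (λ _ → k)
const-polynomial k = k , 0 , λ n _ → ≤-reflexive (sym (*-identityʳ k))

id-polynomial : Polynomial (λ n → n)
id-polynomial = 1 , 1 , λ n _ → ≤-reflexive (sym (trans (*-identityˡ _) (*-identityʳ n)))

+-polynomial : ∀ {f g} → Polynomial f → Polynomial g → Polynomial (λ n → f n + g n)
+-polynomial {f} {g} (c , d , f≤) (c′ , d′ , g≤) = c + c′ , d + d′ , bound
  where
  open ≤-Reasoning
  bound : ∀ n → 1 ≤ n → f n + g n ≤ (c + c′) * n ^ (d + d′)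
  bound n@(suc _) 1≤n = begin
    f n + g n                                  ≤⟨ +-mono-≤ (f≤ n 1≤n) (g≤ n 1≤n) ⟩
    c * n ^ d + c′ * n ^ d′                    ≤⟨ +-mono-≤ (*-monoʳ-≤ c (^-monoʳ-≤ n (m≤m+n d d′)))
                                                            (*-monoʳ-≤ c′ (^-monoʳ-≤ n (m≤n+m d′ d))) ⟩
    c * n ^ (d + d′) + c′ * n ^ (d + d′)       ≡⟨ sym (*-distribʳ-+ (n ^ (d + d′)) c c′) ⟩
    (c + c′) * n ^ (d + d′)                    ∎

*-polynomial : ∀ {f g} → Polynomial f → Polynomial g → Polynomial (λ n → f n * g n)
*-polynomial {f} {g} (c , d , f≤) (c′ , d′ , g≤) = c * c′ , d + d′ , bound
  where
  open ≤-Reasoning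
  bound : ∀ n → 1 ≤ n → f n * g n ≤ c * c′ * n ^ (d + d′)
  bound n 1≤n = begin
    f n * g n                       ≤⟨ *-mono-≤ (f≤ n 1≤n) (g≤ n 1≤n) ⟩
    c * n ^ d * (c′ * n ^ d′)
      ≡⟨ CommutativeSemigroup.interchange *-commutativeSemigroup c (n ^ d) c′ (n ^ d′) ⟩
    c * c′ * (n ^ d * n ^ d′)       ≡⟨ cong (c * c′ *_) (sym (^-distribˡ-+-* n d d′)) ⟩
    c * c′ * n ^ (d + d′)           ∎

cost-polynomial : ∀ p → Polynomial (λ n → cost n p)
cost-polynomial nop            = const-polynomial 1
cost-polynomial (set _ _)      = const-polynomial 1
cost-polynomial (store _ _)    = const-polynomial 1
cost-polynomial (pick _ _)     = const-polynomial 1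
cost-polynomial (p ▸ q)        = +-polynomial (cost-polynomial p) (cost-polynomial q)
cost-polynomial (branch _ p q) =
  +-polynomial (const-polynomial 1) (+-polynomial (cost-polynomial p) (cost-polynomial q))
cost-polynomial (for _ p)      =
  +-polynomial (const-polynomial 2)
    (+-polynomial
      (*-polynomial id-polynomial
        (+-polynomial (const-polynomial 1) (+-polynomial (cost-polynomial p) (const-polynomial 3))))
      (const-polynomial 1))

-- Improvements as sequences of deletions and insertions

put : ℕ → Bool → Subset n → Subset n
put p       b []      = []
put zero    b (_ ∷ S) = b ∷ S
put (suc p) b (x ∷ S) = x ∷ put p b S

lookup-put : ∀ p b (S : Subset n) v →
  lookup (put p b S) v ≡ (if toℕ v ≡ᵇ p then b else lookup S v)
lookup-put zero    b (x ∷ S) zero    = refl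
lookup-put (suc p) b (x ∷ S) zero    = refl
lookup-put zero    b (x ∷ S) (suc v) = refl
lookup-put (suc p) b (x ∷ S) (suc v) = lookup-put p b S v

putAll : Bool → ℕ → (ℕ → ℕ) → Subset n → Subset n
putAll b zero    P S = S
putAll b (suc k) P S = put (P k) b (putAll b k P S)

-- A position that is not a vertex is ignored.
candidate : ℕ → (ℕ → ℕ) → Subset n → Subset n
candidate t P S = putAll true t (λ j → P (t + j)) (putAll false t P S)

putAll-cong : ∀ b k {P Q} (S : Subset n) → (∀ j → j < k → P j ≡ Q j) → putAll b k P S ≡ putAll b k Q S
putAll-cong b zero    S eq = refl
putAll-cong b (suc k) S eq =
  cong₂ (λ p D → put p b D) (eq k ≤-refl) (putAll-cong b k S (λ j j<k → eq j (m≤n⇒m≤1+n j<k)))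

candidate-cong : ∀ t {P Q} (S : Subset n) → (∀ j → j < t + t → P j ≡ Q j) →
  candidate t P S ≡ candidate t Q S
candidate-cong t {P} {Q} S eq = trans
  (cong (putAll true t (λ j → P (t + j))) (putAll-cong false t S (λ j j<t → eq j (≤-trans j<t (m≤m+n t t)))))
  (putAll-cong true t _ (λ j j<t → eq (t + j) (+-monoʳ-< t j<t)))

-- All writes carry the same bit, so a later write to the same place does no harm; this is what
-- permits repetitions.
putAll-hit : ∀ b k P (S : Subset n) v j → j < k → P j ≡ toℕ v → lookup (putAll b k P S) v ≡ b
putAll-hit b (suc k) P S v j (s≤s j≤k) eq rewrite lookup-put (P k) b (putAll b k P S) v
  with toℕ v ≡ᵇ P k in v≟Pk
... | true  = refl
... | false = putAll-hit b k P S v j (≤∧≢⇒< j≤k j≢k) eq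
  where
  j≢k : j ≢ k
  j≢k refl with () ← trans (sym v≟Pk) (≡⇒≡ᵇ-true (sym eq))

putAll-miss : ∀ b k P (S : Subset n) v → (∀ j → j < k → P j ≢ toℕ v) →
  lookup (putAll b k P S) v ≡ lookup S v
putAll-miss b zero    P S v miss = refl
putAll-miss b (suc k) P S v miss
  rewrite lookup-put (P k) b (putAll b k P S) v | ≢⇒≡ᵇ-false (miss k ≤-refl ∘ sym)
  = putAll-miss b k P S v (λ j j<k → miss j (m≤n⇒m≤1+n j<k))

∣S─S∣≡0 : (S : Subset n) → ∣ S ─ S ∣ ≡ 0
∣S─S∣≡0 []            = refl
∣S─S∣≡0 (inside  ∷ S) = ∣S─S∣≡0 S
∣S─S∣≡0 (outside ∷ S) = ∣S─S∣≡0 S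

-- The reference set S stays fixed while D is edited: an insertion adds at most one vertex outside
-- S, a deletion none.
∣put─∣ : ∀ p b (D S : Subset n) → ∣ put p b D ─ S ∣ ≤ (if b then 1 else 0) + ∣ D ─ S ∣
∣put─∣ p       b []            []            = z≤n
∣put─∣ zero    b (d ∷ D)       (inside  ∷ S) = m≤n+m _ (if b then 1 else 0)
∣put─∣ zero    false (false ∷ D) (outside ∷ S) = ≤-refl
∣put─∣ zero    false (true ∷ D) (outside ∷ S) = n≤1+n _
∣put─∣ zero    true (false ∷ D) (outside ∷ S) = ≤-refl
∣put─∣ zero    true (true ∷ D) (outside ∷ S) = n≤1+n _
∣put─∣ (suc p) b (d ∷ D)       (inside  ∷ S) = ∣put─∣ p b D S
∣put─∣ (suc p) b (false ∷ D)   (outside ∷ S) = ∣put─∣ p b D S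
∣put─∣ (suc p) b (true  ∷ D)   (outside ∷ S) =
  ≤-trans (s≤s (∣put─∣ p b D S)) (≤-reflexive (sym (+-suc (if b then 1 else 0) _)))

∣putAll─∣ : ∀ b k P (D S : Subset n) → ∣ putAll b k P D ─ S ∣ ≤ k * (if b then 1 else 0) + ∣ D ─ S ∣
∣putAll─∣ b zero    P D S = ≤-refl
∣putAll─∣ b (suc k) P D S = ≤-trans (∣put─∣ (P k) b (putAll b k P D) S)
  (≤-trans (+-monoʳ-≤ (if b then 1 else 0) (∣putAll─∣ b k P D S))
           (≤-reflexive (sym (+-assoc (if b then 1 else 0) _ _))))

∣candidate─S∣≤t : ∀ t P (S : Subset n) → ∣ candidate t P S ─ S ∣ ≤ t
∣candidate─S∣≤t t P S = begin
  ∣ candidate t P S ─ S ∣                 ≤⟨ ∣putAll─∣ true t _ (putAll false t P S) S ⟩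
  t * 1 + ∣ putAll false t P S ─ S ∣      ≤⟨ +-monoʳ-≤ (t * 1) (∣putAll─∣ false t P S S) ⟩
  t * 1 + (t * 0 + ∣ S ─ S ∣)             ≡⟨ cong₂ _+_ (*-identityʳ t) (cong₂ _+_ (*-zeroʳ t) (∣S─S∣≡0 S)) ⟩
  t + 0                                   ≡⟨ +-identityʳ t ⟩
  t                                       ∎
  where open ≤-Reasoning

-- Both sides count the union of `S` and `C`.
∣S∣+∣C─S∣ : (S C : Subset n) → ∣ S ∣ + ∣ C ─ S ∣ ≡ ∣ C ∣ + ∣ S ─ C ∣
∣S∣+∣C─S∣ []            []            = refl
∣S∣+∣C─S∣ (inside  ∷ S) (inside  ∷ C) = cong suc (∣S∣+∣C─S∣ S C)
∣S∣+∣C─S∣ (inside  ∷ S) (outside ∷ C) = trans (cong suc (∣S∣+∣C─S∣ S C)) (sym (+-suc ∣ C ∣ _))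
∣S∣+∣C─S∣ (outside ∷ S) (inside  ∷ C) = trans (+-suc ∣ S ∣ _) (cong suc (∣S∣+∣C─S∣ S C))
∣S∣+∣C─S∣ (outside ∷ S) (outside ∷ C) = ∣S∣+∣C─S∣ S C

exchange-─ : (S C : Subset n) → C ≡ (S ─ (S ─ C)) ∪ (C ─ S)
exchange-─ []            []            = refl
exchange-─ (inside  ∷ S) (inside  ∷ C) = cong (inside ∷_) (exchange-─ S C)
exchange-─ (inside  ∷ S) (outside ∷ C) = cong (outside ∷_) (exchange-─ S C)
exchange-─ (outside ∷ S) (inside  ∷ C) = cong (inside ∷_) (exchange-─ S C)
exchange-─ (outside ∷ S) (outside ∷ C) = cong (outside ∷_) (exchange-─ S C)

-- This is what the program tests; the limit on |Y| is built into the format of candidates.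
Better : Graph (Fin n) → Subset n → Subset n → Set
Better G S C = Independent G C × ∣ S ∣ < ∣ C ∣

-- The exchange is read off from the result, with `S ─ C` for X and `C ─ S` for Y, so that a vertex
-- deleted and reinserted cancels.
candidate-improvement : ∀ {t} {G : Graph (Fin n)} P S → Better G S (candidate t P S) →
  Improvement t G S (candidate t P S)
candidate-improvement {t = t} P S (ind , larger) = record
  { X           = S ─ C
  ; Y           = C ─ S
  ; X⊆S         = p─q⊆p S C
  ; Y⊆V∖S       = λ i → x∉p⇒x∈∁p (x∈p─q⇒x∉q C S i)
  ; ∣X∣<∣Y∣     = +-cancelˡ-< ∣ S ∣ _ _ (begin-strict
      ∣ S ∣ + ∣ S ─ C ∣   <⟨ +-monoˡ-< ∣ S ─ C ∣ larger ⟩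
      ∣ C ∣ + ∣ S ─ C ∣   ≡⟨ sym (∣S∣+∣C─S∣ S C) ⟩
      ∣ S ∣ + ∣ C ─ S ∣   ∎)
  ; ∣Y∣≤t       = ∣candidate─S∣≤t t P S
  ; exchange    = exchange-─ S C
  ; independent = ind
  }
  where
  open ≤-Reasoning
  C = candidate t P S

getOr : A → List A → ℕ → A
getOr d []       _       = d
getOr d (x ∷ xs) zero    = x
getOr d (x ∷ xs) (suc j) = getOr d xs j

getOr-∈ : ∀ (d : A) xs j → getOr d xs j ≡ d ⊎ getOr d xs j ∈ₗ xs
getOr-∈ d []       j       = inj₁ refl
getOr-∈ d (x ∷ xs) zero    = inj₂ (here refl)
getOr-∈ d (x ∷ xs) (suc j) with getOr-∈ d xs j
... | inj₁ eq = inj₁ eq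
... | inj₂ i  = inj₂ (there i)

∈-getOr : ∀ (d : A) {x xs} → x ∈ₗ xs → ∃[ j ] (j < length xs × getOr d xs j ≡ x)
∈-getOr d (here refl) = 0 , s≤s z≤n , refl
∈-getOr d (there i) with ∈-getOr d i
... | j , j< , eq = suc j , s≤s j< , eq

splice : ℕ → (ℕ → A) → (ℕ → A) → ℕ → A
splice zero    f g j       = g j
splice (suc t) f g zero    = f 0
splice (suc t) f g (suc j) = splice t (f ∘ suc) g j

splice-< : ∀ t (f g : ℕ → A) j → j < t → splice t f g j ≡ f j
splice-< (suc t) f g zero    _       = refl
splice-< (suc t) f g (suc j) (s≤s p) = splice-< t (f ∘ suc) g j p

splice-+ : ∀ t (f g : ℕ → A) j → splice t f g (t + j) ≡ g j
splice-+ zero    f g j = refl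
splice-+ (suc t) f g j = splice-+ t (f ∘ suc) g j

-- Unused positions repeat an element of Y: candidate clears before it sets.
improvement-candidate : ∀ {t} {G : Graph (Fin n)} {S S′} → Improvement t G S S′ →
  ∃[ P ] ((∀ j → P j < n) × candidate t P S ≡ S′)
improvement-candidate {n} {t} {G} {S} {S′} imp with elements (Improvement.Y imp) in elements-Y
-- `Y` is nonempty because |X| < |Y|; the padding element y comes from it.
... | [] = contradiction (Improvement.∣X∣<∣Y∣ imp)
             (subst (λ m → ¬ (∣ Improvement.X imp ∣ < m))
               (trans (cong length (sym elements-Y)) (length-elements (Improvement.Y imp))) λ ())
... | y ∷ _ = P , (λ j → Fin.toℕ<n (places j)) ,
              trans (⊆-antisym C⊆ ⊆C) (sym exchange)
  where
  open Improvement imp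

  y∈Y : y ∈ Y
  y∈Y = ∈-elements⁻ Y (subst (y ∈ₗ_) (sym elements-Y) (here refl))

  f g : ℕ → Fin n
  f = getOr y (elements X)
  g = getOr y (elements Y)

  places : ℕ → Fin n
  places = splice t f g

  P : ℕ → ℕ
  P j = toℕ (places j)

  f∈ : ∀ j → f j ∈ X ⊎ f j ∈ Y
  f∈ j with getOr-∈ y (elements X) j
  ... | inj₁ eq = inj₂ (subst (_∈ Y) (sym eq) y∈Y)
  ... | inj₂ i  = inj₁ (∈-elements⁻ X i)

  g∈ : ∀ j → g j ∈ Y
  g∈ j with getOr-∈ y (elements Y) j
  ... | inj₁ eq = subst (_∈ Y) (sym eq) y∈Y
  ... | inj₂ i  = ∈-elements⁻ Y i

  D C : Subset n
  D = putAll false t P S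
  C = candidate t P S

  in-Y : ∀ {v} → v ∈ Y → v ∈ C
  in-Y {v} v∈Y with ∈-getOr y (∈-elements⁺ v∈Y)
  ... | j , j< , eq = lookup⇒[]= v C (putAll-hit true t _ D v j
    (≤-trans j< (≤-trans (≤-reflexive (length-elements Y)) ∣Y∣≤t))
    (cong toℕ (trans (splice-+ t f g j) eq)))

  off-Y : ∀ {v} → v ∉ Y → lookup C v ≡ lookup D v
  off-Y {v} v∉Y = putAll-miss true t _ D v λ j _ eq →
    v∉Y (subst (_∈ Y) (trans (sym (splice-+ t f g j)) (Fin.toℕ-injective eq)) (g∈ j))

  in-X : ∀ {v} → v ∈ X → lookup D v ≡ false
  in-X {v} v∈X with ∈-getOr y (∈-elements⁺ v∈X)
  ... | j , j< , eq = putAll-hit false t P S v j j<t (cong toℕ (trans (splice-< t f g j j<t) eq))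
    where
    j<t = ≤-trans j< (≤-trans (≤-reflexive (length-elements X)) (≤-trans (<⇒≤ ∣X∣<∣Y∣) ∣Y∣≤t))

  off-X∪Y : ∀ {v} → v ∉ X → v ∉ Y → lookup D v ≡ lookup S v
  off-X∪Y {v} v∉X v∉Y = putAll-miss false t P S v λ j j<t eq →
    [ v∉X ∘ subst (_∈ X) (fj≡v j j<t eq) , v∉Y ∘ subst (_∈ Y) (fj≡v j j<t eq) ]′ (f∈ j)
    where
    fj≡v : ∀ j → j < t → P j ≡ toℕ v → f j ≡ v
    fj≡v j j<t eq = trans (sym (splice-< t f g j j<t)) (Fin.toℕ-injective eq)

  C⊆ : C ⊆ (S ─ X) ∪ Y
  C⊆ {v} v∈C with v ∈? Y | v ∈? X
  ... | yes v∈Y | _       = x∈p∪q⁺ (inj₂ v∈Y)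
  ... | no v∉Y  | yes v∈X
    with () ← trans (sym ([]=⇒lookup v∈C)) (trans (off-Y v∉Y) (in-X v∈X))
  ... | no v∉Y  | no v∉X  = x∈p∪q⁺ (inj₁ (x∈p∧x∉q⇒x∈p─q
    (lookup⇒[]= v S (trans (sym (trans (off-Y v∉Y) (off-X∪Y v∉X v∉Y))) ([]=⇒lookup v∈C))) v∉X))

  ⊆C : (S ─ X) ∪ Y ⊆ C
  ⊆C {v} i with x∈p∪q⁻ (S ─ X) Y i | v ∈? Y
  ... | _      | yes v∈Y = in-Y v∈Y
  ... | inj₂ j | no v∉Y  = contradiction j v∉Y
  ... | inj₁ j | no v∉Y  = lookup⇒[]= v C
    (trans (trans (off-Y v∉Y) (off-X∪Y (x∈p─q⇒x∉q S X j) v∉Y)) ([]=⇒lookup (p─q⊆p S X j)))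

-- The improvement step

update-here : ∀ (f : ℕ → ℕ) {x w} c → w ≡ x → (f [ x ↦ c ]) w ≡ c
update-here f c w≡x rewrite ≡⇒≡ᵇ-true w≡x = refl

update-other : ∀ (f : ℕ → ℕ) {x w} c → w ≢ x → (f [ x ↦ c ]) w ≡ f w
update-other f c w≢x rewrite ≢⇒≡ᵇ-false w≢x = refl

sumBelow : ℕ → (ℕ → ℕ) → ℕ
sumBelow zero    f = 0
sumBelow (suc k) f = sumBelow k f + f k

-- `sumBelow` adds its last term, as a loop round does, whereas subsets are consumed from the head;
-- this reconciles the two.
sumBelow-suc : ∀ k f → sumBelow (suc k) f ≡ f 0 + sumBelow k (f ∘ suc)
sumBelow-suc zero    f = sym (+-identityʳ (f 0))
sumBelow-suc (suc k) f =
  trans (cong (_+ f (suc k)) (sumBelow-suc k f)) (+-assoc (f 0) _ (f (suc k)))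

sumBelow-cardinality : ∀ (S : Subset n) f → (∀ v → f (toℕ v) ≡ bit (lookup S v)) → sumBelow n f ≡ ∣ S ∣
sumBelow-cardinality         []      f eq = refl
sumBelow-cardinality {suc n} (b ∷ S) f eq = trans (sumBelow-suc n f)
  (trans (cong₂ _+_ (eq zero) (sumBelow-cardinality S (f ∘ suc) (eq ∘ suc))) (bit-+ b))
  where
  bit-+ : ∀ b → bit b + ∣ S ∣ ≡ ∣ b ∷ S ∣
  bit-+ true  = refl
  bit-+ false = refl

sumBelow≡0⇒ : ∀ k f → sumBelow k f ≡ 0 → ∀ j → j < k → f j ≡ 0
sumBelow≡0⇒ (suc k) f eq j (s≤s j≤k) with j ≟ k
... | yes refl = m+n≡0⇒n≡0 (sumBelow k f) eq
... | no j≢k   = sumBelow≡0⇒ k f (m+n≡0⇒m≡0 (sumBelow k f) eq) j (≤∧≢⇒< j≤k j≢k)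

sumBelow≡0⇐ : ∀ k f → (∀ j → j < k → f j ≡ 0) → sumBelow k f ≡ 0
sumBelow≡0⇐ zero    f eq = refl
sumBelow≡0⇐ (suc k) f eq = cong₂ _+_ (sumBelow≡0⇐ k f (λ j j<k → eq j (m≤n⇒m≤1+n j<k))) (eq k ≤-refl)

edgeBit-adj : ∀ (G : Graph (Fin n)) u v → edgeBit G (toℕ u) (toℕ v) ≡ bit (adj G u v)
edgeBit-adj {n} G u v with toℕ u <? n | toℕ v <? n
... | yes p | yes q = cong₂ (λ x y → bit (adj G x y)) (Fin.fromℕ<-toℕ u p) (Fin.fromℕ<-toℕ v q)
... | yes p | no ¬q = contradiction (Fin.toℕ<n v) ¬q
... | no ¬p | _     = contradiction (Fin.toℕ<n u) ¬p

rowI rowJ val addr cell old new bad two gain zeroReg : Reg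
rowI    = 5
rowJ    = 6
val     = 7
addr    = 8
cell    = 9
old     = 10
new     = 11
bad     = 12
two     = 13
gain    = 14
zeroReg = 15

position : ℕ → Reg
position j = 16 + j

positions : State → ℕ → ℕ
positions s j = reg s (position j)

-- The modified set is built in cells n, …, 2n ∸ 1; a chosen position n hits the unused cell 2n.
transferCell transfer : Prog
transferCell = set val (load rowI) ▸ set addr (order ⊕ rowI) ▸ store addr val
transfer     = for rowI transferCell

mark : Reg → Reg → ℕ → ℕ → Prog
mark base a o zero    = nop
mark base a o (suc k) = mark base a o k ▸ set addr (base ⊕ position (o + k)) ▸ store addr a

-- `base` is a register holding a start address: `order` for the working copy at n, `zeroReg` for
-- the set itself at 0. `zeroReg` is also the bit written by deletions.
edit : ℕ → Reg → Prog
edit t base = set zeroReg (const 0) ▸ set one (const 1) ▸ mark base zeroReg 0 t ▸ mark base one t t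

-- The sum of the two membership bits and the edge bit exceeds 2 only for adjacent members.
checkPair checkRow addRow : Prog
checkPair =
  set addr (order ⊕ rowJ) ▸ set cell (load addr) ▸ set cell (cell ⊕ val) ▸
  set addr (edge rowI rowJ) ▸ set cell (cell ⊕ addr) ▸ set cell (cell ⊖ two) ▸
  set bad (bad ⊕ cell)
checkRow  = for rowJ checkPair
addRow    =
  set val (load rowI) ▸ set old (old ⊕ val) ▸ set addr (order ⊕ rowI) ▸
  set val (load addr) ▸ set new (new ⊕ val)

check : Prog
check =
  set old (const 0) ▸ set new (const 0) ▸ set bad (const 0) ▸ set two (const 2) ▸
  for rowI (addRow ▸ checkRow)

-- Truncated subtraction stands in for a comparison of cardinalities. Only an accepted candidate
-- touches the set itself: the same edit is replayed at address 0.
accept : ℕ → Prog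
accept t = set gain (new ⊖ old) ▸
  branch bad nop (branch gain (edit t zeroReg ▸ set found (const 1)) nop)

-- The guard on `found` makes every attempt after a success idle, so the nested loops may simply run
-- to their end. Opacity keeps this large program folded in the reasoning about those loops.
opaque
  attempt : ℕ → Prog
  attempt t = branch found nop (transfer ▸ edit t order ▸ check ▸ accept t)

guess : ℕ → Prog
guess zero    = nop
guess (suc k) = guess k ▸ pick (position k) order

-- The loop counters are the position registers themselves, the outermost loop driving the highest
-- one, so the innermost program meets every d-tuple of vertices.
search : ℕ → Prog → Prog
search zero    p = p
search (suc d) p = for (position d) (search d p)

improvement : ℕ → Prog
improvement t =
  set found (const 0) ▸ guess (t + t) ▸ attempt t ▸ search (t + t) (attempt t)

-- Registers assigned and safety of the loops

mark-assigns : ∀ base a o k r → (r ≡ᵇ addr) ≡ false → assigns (mark base a o k) r ≡ false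
mark-assigns base a o zero    r eq = refl
mark-assigns base a o (suc k) r eq rewrite mark-assigns base a o k r eq | eq = refl

mark-loopSafe : ∀ base a o k → LoopSafe (mark base a o k)
mark-loopSafe base a o zero    = tt
mark-loopSafe base a o (suc k) = mark-loopSafe base a o k , tt , tt

edit-loopSafe : ∀ t base → LoopSafe (edit t base)
edit-loopSafe t base = tt , tt , mark-loopSafe base zeroReg 0 t , mark-loopSafe base one t t

edit-assigns : ∀ t base r → (r ≡ᵇ zeroReg) ≡ false → (r ≡ᵇ one) ≡ false → (r ≡ᵇ addr) ≡ false →
  assigns (edit t base) r ≡ false
edit-assigns t base r p q eq
  rewrite p | q | mark-assigns base zeroReg 0 t r eq | mark-assigns base one t t r eq = refl

opaque
  unfolding attempt

  attempt-assigns-order : ∀ t → assigns (attempt t) order ≡ false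
  attempt-assigns-order t
    rewrite edit-assigns t order order refl refl refl | edit-assigns t zeroReg order refl refl refl = refl

  attempt-assigns-position : ∀ t j → assigns (attempt t) (position j) ≡ false
  attempt-assigns-position t j
    rewrite edit-assigns t order (position j) refl refl refl
          | edit-assigns t zeroReg (position j) refl refl refl = refl

  attempt-loopSafe : ∀ t → LoopSafe (attempt t)
  attempt-loopSafe t =
    tt , (refl , refl , refl , tt , tt , tt) , edit-loopSafe t order ,
    (tt , tt , tt , tt , refl , refl , refl , (tt , tt , tt , tt , tt) ,
     refl , refl , refl , tt , tt , tt , tt , tt , tt , tt) ,
    tt , tt , (edit-loopSafe t zeroReg , tt) , tt

search-assigns-order : ∀ d p → assigns p order ≡ false → assigns (search d p) order ≡ false
search-assigns-order zero    p eq = eq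
search-assigns-order (suc d) p eq = search-assigns-order d p eq

search-assigns-position : ∀ d p → (∀ j → assigns p (position j) ≡ false) →
  ∀ j → d ≤ j → assigns (search d p) (position j) ≡ false
search-assigns-position zero    p eq j _ = eq j
search-assigns-position (suc d) p eq j d<j
  rewrite >⇒≡ᵇ-false d<j = search-assigns-position d p eq j (<⇒≤ d<j)

search-loopSafe : ∀ d p → LoopSafe p → (∀ j → assigns p (position j) ≡ false) → LoopSafe (search d p)
search-loopSafe zero    p safe eq = safe
search-loopSafe (suc d) p safe eq =
  refl , refl , search-assigns-position d p eq d ≤-refl , search-loopSafe d p safe eq

guess-assigns : ∀ k r → (∀ j → j < k → (r ≡ᵇ position j) ≡ false) → assigns (guess k) r ≡ false
guess-assigns zero    r eq = refl
guess-assigns (suc k) r eq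
  rewrite guess-assigns k r (λ j j<k → eq j (m≤n⇒m≤1+n j<k)) | eq k ≤-refl = refl

guess-loopSafe : ∀ k → LoopSafe (guess k)
guess-loopSafe zero    = tt
guess-loopSafe (suc k) = guess-loopSafe k , tt

improvement-loopSafe : ∀ t → LoopSafe (improvement t)
improvement-loopSafe t =
  tt , guess-loopSafe (t + t) , attempt-loopSafe t ,
  search-loopSafe (t + t) (attempt t) (attempt-loopSafe t) (attempt-assigns-position t)

improvement-assigns-order : ∀ t → assigns (improvement t) order ≡ false
improvement-assigns-order t
  rewrite guess-assigns (t + t) order (λ _ _ → refl)
        | attempt-assigns-order t
        | search-assigns-order (t + t) (attempt t) (attempt-assigns-order t) = refl

-- Effect of each component on memory and registers

HoldsAt : ℕ → Subset n → State → Set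
HoldsAt o S s = ∀ v → mem s (o + toℕ v) ≡ bit (lookup S v)

module Specification {n} (G : Graph (Fin n)) where
  open Semantics G

  transfer-spec : ∀ S s → Holds S s → HoldsAt 0 S (⟦ transfer ⟧ s) × HoldsAt n S (⟦ transfer ⟧ s)
  transfer-spec S s (o , h) with
    Loop.invariant rowI transferCell refl refl refl refl I step s o (h , λ _ ())
    where
    I : ℕ → State → Set
    I j s = HoldsAt 0 S s × (∀ v → toℕ v < j → mem s (n + toℕ v) ≡ bit (lookup S v))
    step : ∀ j s → j < n → reg s rowI ≡ j → reg s order ≡ n → I j s →
      I (suc j) (advance rowI (⟦ transferCell ⟧ s))
    step j s j<n refl refl (h , h′) = low , high
      where
      low : ∀ v → _
      low v = trans (update-other (mem s) _ (<⇒≢ (≤-trans (Fin.toℕ<n v) (m≤m+n _ _)))) (h v)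
      high : ∀ v → _ → _
      high v (s≤s v≤j) with toℕ v ≟ reg s rowI
      ... | yes eq = trans (update-here (mem s) _ (cong (n +_) eq)) (trans (cong (mem s) (sym eq)) (h v))
      ... | no neq = trans (update-other (mem s) _ (neq ∘ +-cancelˡ-≡ n _ _)) (h′ v (≤∧≢⇒< v≤j neq))
  ... | h₀ , h₁ = h₀ , λ v → h₁ v (Fin.toℕ<n v)

  -- `mark` assigns no register but `addr`, so base address, bit and positions keep their initial
  -- values; the base address then cancels when cells are compared.
  mark-spec : ∀ base a o k s b (D : Subset n) →
    (base ≡ᵇ addr) ≡ false → (a ≡ᵇ addr) ≡ false → reg s a ≡ bit b → HoldsAt (reg s base) D s →
    HoldsAt (reg s base) (putAll b k (λ j → positions s (o + j)) D) (⟦ mark base a o k ⟧ s)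
  mark-spec base a o zero    s b D _ _ _ h = h
  mark-spec base a o (suc k) s b D base≢ a≢ a≡b h v
    rewrite lookup-put (positions s (o + k)) b (putAll b k (λ j → positions s (o + j)) D) v
          | a≢
          | frame (mark base a o k) base s (mark-assigns base a o k base base≢)
          | frame (mark base a o k) (position (o + k)) s (mark-assigns base a o k (position (o + k)) refl)
          | +-≡ᵇ-cancelˡ (reg s base) (toℕ v) (positions s (o + k))
    with toℕ v ≡ᵇ positions s (o + k)
  ... | true  = trans (frame (mark base a o k) a s (mark-assigns base a o k a a≢)) a≡b
  ... | false = mark-spec base a o k s b D base≢ a≢ a≡b h v

  -- Editing the copy leaves the current set intact, so a rejected candidate needs no undoing.
  mark-below : ∀ base a o k s → (base ≡ᵇ addr) ≡ false → ∀ w → w < reg s base →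
    mem (⟦ mark base a o k ⟧ s) w ≡ mem s w
  mark-below base a o zero    s _     w _   = refl
  mark-below base a o (suc k) s base≢ w w< = trans
    (update-other (mem (⟦ mark base a o k ⟧ s)) _ (<⇒≢ (≤-trans w<
      (≤-trans (≤-reflexive (sym (frame (mark base a o k) base s (mark-assigns base a o k base base≢))))
               (m≤m+n _ _)))))
    (mark-below base a o k s base≢ w w<)

  module _ (t : ℕ) (base : Reg) (base≢addr : (base ≡ᵇ addr) ≡ false) where

    private
      ready : State → State
      ready s = setTo one (const 1) (setTo zeroReg (const 0) s)

      erased : State → State
      erased s = ⟦ mark base zeroReg 0 t ⟧ (ready s)

      erased-frame : ∀ r s → (r ≡ᵇ addr) ≡ false → reg (erased s) r ≡ reg (ready s) r
      erased-frame r s eq = frame (mark base zeroReg 0 t) r (ready s) (mark-assigns base zeroReg 0 t r eq)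

    -- The base address is read after the two initial assignments, since `zeroReg` may itself be the
    -- base.
    edit-spec : ∀ (S : Subset n) s → HoldsAt (reg (ready s) base) S s →
      HoldsAt (reg (ready s) base) (candidate t (positions s) S) (⟦ edit t base ⟧ s)
    edit-spec S s h v = trans
      (subst (λ m → HoldsAt m (putAll true t (λ j → positions (erased s) (t + j)) D) (⟦ edit t base ⟧ s))
         (erased-frame base s base≢addr)
         (mark-spec base one t t (erased s) true D base≢addr refl (erased-frame one s refl)
           (subst (λ m → HoldsAt m D (erased s)) (sym (erased-frame base s base≢addr))
             (mark-spec base zeroReg 0 t (ready s) false S base≢addr refl refl h)))
         v)
      (cong (λ C → bit (lookup C v))
        (putAll-cong true t D (λ j _ → erased-frame (position (t + j)) s refl)))
      where
      D = putAll false t (positions s) S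

    edit-below : ∀ s w → w < reg (ready s) base → mem (⟦ edit t base ⟧ s) w ≡ mem s w
    edit-below s w w< = trans
      (mark-below base one t t (erased s) base≢addr w
        (≤-trans w< (≤-reflexive (sym (erased-frame base s base≢addr)))))
      (mark-below base zeroReg 0 t (ready s) base≢addr w w<)

  -- The amount that `checkPair` adds to `bad`, with the summands in the order of the program. On
  -- membership bits it is 1 for adjacent members and 0 otherwise.
  conflict : (ℕ → ℕ) → ℕ → ℕ → ℕ
  conflict μ u v = (μ (n + v) + μ (n + u) + edgeBit G u v) ∸ 2

  conflicts : (ℕ → ℕ) → ℕ → ℕ
  conflicts μ u = sumBelow n (conflict μ u)

  checkRow-spec : ∀ s μ → reg s order ≡ n → mem s ≡ μ → reg s two ≡ 2 →
    reg s val ≡ μ (n + reg s rowI) →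
    mem (⟦ checkRow ⟧ s) ≡ μ × reg (⟦ checkRow ⟧ s) bad ≡ reg s bad + conflicts μ (reg s rowI)
  checkRow-spec s μ o refl two≡ val≡ with
    Loop.invariant rowJ checkPair refl refl refl refl I step s o
      (refl , refl , two≡ , val≡ , sym (+-identityʳ (reg s bad)))
    where
    I : ℕ → State → Set
    I j s′ = mem s′ ≡ mem s × reg s′ rowI ≡ reg s rowI × reg s′ two ≡ 2 ×
      reg s′ val ≡ mem s (n + reg s rowI) ×
      reg s′ bad ≡ reg s bad + sumBelow j (conflict (mem s) (reg s rowI))
    step : ∀ j s′ → j < n → reg s′ rowJ ≡ j → reg s′ order ≡ n → I j s′ →
      I (suc j) (advance rowJ (⟦ checkPair ⟧ s′))
    step j s′ _ refl o′ (m , i , t , v , b) = m , i , t , v ,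
      trans (cong₂ _+_ b
        (cong₂ _∸_ (cong₂ _+_ (cong₂ _+_ (cong₂ (λ f x → f (x + reg s′ rowJ)) m o′) v)
                              (cong (λ x → edgeBit G x (reg s′ rowJ)) i)) t))
        (+-assoc (reg s bad) _ _)
  ... | m , _ , _ , _ , b = m , b

  check-spec : ∀ s → reg s order ≡ n →
    let s′ = ⟦ check ⟧ s in
    mem s′ ≡ mem s × reg s′ old ≡ sumBelow n (mem s) ×
    reg s′ new ≡ sumBelow n (λ v → mem s (n + v)) × reg s′ bad ≡ sumBelow n (conflicts (mem s))
  check-spec s o with
    Loop.invariant rowI (addRow ▸ checkRow) refl refl refl refl I step
      (setTo two (const 2) (setTo bad (const 0) (setTo new (const 0) (setTo old (const 0) s)))) o
      (refl , refl , refl , refl , refl)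
    where
    I : ℕ → State → Set
    I j s′ = mem s′ ≡ mem s × reg s′ two ≡ 2 × reg s′ old ≡ sumBelow j (mem s) ×
      reg s′ new ≡ sumBelow j (λ v → mem s (n + v)) × reg s′ bad ≡ sumBelow j (conflicts (mem s))
    step : ∀ j s′ → j < n → reg s′ rowI ≡ j → reg s′ order ≡ n → I j s′ →
      I (suc j) (advance rowI (⟦ checkRow ⟧ (⟦ addRow ⟧ s′)))
    step j s′ _ refl o′ (m , t , a , c , b)
      with checkRow-spec (⟦ addRow ⟧ s′)
             (mem s) o′ m t (cong₂ (λ f x → f (x + reg s′ rowI)) m o′)
    ... | m′ , b′ = m′ , trans (frame checkRow two (⟦ addRow ⟧ s′) refl) t ,
      trans (frame checkRow old (⟦ addRow ⟧ s′) refl) (cong₂ _+_ a (cong (λ f → f (reg s′ rowI)) m)) ,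
      trans (frame checkRow new (⟦ addRow ⟧ s′) refl) (cong₂ _+_ c (cong₂ (λ f x → f (x + reg s′ rowI)) m o′)) ,
      trans b′ (cong (_+ conflicts (mem s) (reg s′ rowI)) b)
  ... | m , _ , a , c , b = m , a , c , b

  conflict-toℕ : ∀ {μ} {C : Subset n} → (∀ v → μ (n + toℕ v) ≡ bit (lookup C v)) →
    ∀ u v → conflict μ (toℕ u) (toℕ v) ≡ (bit (lookup C v) + bit (lookup C u) + bit (adj G u v)) ∸ 2
  conflict-toℕ h u v = cong (_∸ 2) (cong₂ _+_ (cong₂ _+_ (h v) (h u)) (edgeBit-adj G u v))

  conflict-free⇒independent : ∀ {μ} {C : Subset n} → (∀ v → μ (n + toℕ v) ≡ bit (lookup C v)) →
    sumBelow n (conflicts μ) ≡ 0 → Independent G C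
  conflict-free⇒independent {μ} {C} h eq {u} {v} u∈C v∈C = no-edge
    (trans (sym (conflict-toℕ {μ} {C} h u v))
      (sumBelow≡0⇒ n _ (sumBelow≡0⇒ n _ eq (toℕ u) (Fin.toℕ<n u)) (toℕ v) (Fin.toℕ<n v)))
    where
    no-edge : (bit (lookup C v) + bit (lookup C u) + bit (adj G u v)) ∸ 2 ≡ 0 → adj G u v ≡ false
    no-edge rewrite []=⇒lookup u∈C | []=⇒lookup v∈C with adj G u v
    ... | false = λ _ → refl
    ... | true  = λ ()

  independent⇒conflict-free : ∀ {μ} {C : Subset n} → (∀ v → μ (n + toℕ v) ≡ bit (lookup C v)) →
    Independent G C → sumBelow n (conflicts μ) ≡ 0
  independent⇒conflict-free {μ} {C} h ind = sumBelow≡0⇐ n _ λ u u<n → sumBelow≡0⇐ n _ λ v v<n →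
    subst₂ (λ x y → conflict μ x y ≡ 0) (Fin.toℕ-fromℕ< u<n) (Fin.toℕ-fromℕ< v<n)
      (trans (conflict-toℕ {μ} {C} h (fromℕ< u<n) (fromℕ< v<n)) (vanishes (fromℕ< u<n) (fromℕ< v<n)))
    where
    vanishes : ∀ u v → (bit (lookup C v) + bit (lookup C u) + bit (adj G u v)) ∸ 2 ≡ 0
    vanishes u v with lookup C v in eqv | lookup C u in equ
    ... | true  | true  rewrite ind (lookup⇒[]= u C equ) (lookup⇒[]= v C eqv) = refl
    ... | true  | false with adj G u v
    ...   | true  = refl
    ...   | false = refl
    vanishes u v | false | true with adj G u v
    ...   | true  = refl
    ...   | false = refl
    vanishes u v | false | false with adj G u v
    ...   | true  = refl
    ...   | false = refl

ifNonzero-elim : (Q : State → Set) → ∀ k {s s′} → (k ≢ 0 → Q s) → (k ≡ 0 → Q s′) → Q (ifNonzero k s s′)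
ifNonzero-elim Q zero    _ q = q refl
ifNonzero-elim Q (suc k) p _ = p λ ()

-- Correctness of one improvement step and of its iteration

module Correctness {n} (G : Graph (Fin n)) (t : ℕ) where
  open Semantics G
  open Specification G

  -- Failure also records that the candidate is not better; the exhaustive search collects these
  -- refutations into local optimality.
  Accepts : Subset n → Subset n → State → Set
  Accepts S C s =
    (reg s found ≢ 0 × Better G S C × Holds C s) ⊎ (reg s found ≡ 0 × ¬ Better G S C × Holds S s)

  accept-spec : ∀ S s → Holds S s → reg s found ≡ 0 →
    (let C = candidate t (positions s) S) →
    reg s old ≡ ∣ S ∣ → reg s new ≡ ∣ C ∣ → (reg s bad ≡ 0 → Independent G C) →
    (Independent G C → reg s bad ≡ 0) → Accepts S C (⟦ accept t ⟧ s)
  accept-spec S s (o , h) f≡0 old≡ new≡ sound complete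
    = ifNonzero-elim (Accepts S C) (reg s bad)
        (λ bad≢0 → inj₂ (f≡0 , (λ (ind , _) → bad≢0 (complete ind)) , o , h))
        (λ bad≡0 → ifNonzero-elim (Accepts S C) (reg s new ∸ reg s old)
          (λ gain≢0 → inj₁ ((λ ()) , (sound bad≡0 , larger gain≢0) ,
            trans (frame (edit t zeroReg) order s₁ (edit-assigns t zeroReg order refl refl refl)) o ,
            edit-spec t zeroReg refl S s₁ h))
          (λ gain≡0 → inj₂ (f≡0 , (λ (_ , better) → <⇒≱ better (not-larger gain≡0)) , o , h)))
    where
    C  = candidate t (positions s) S
    s₁ = setTo gain (new ⊖ old) s
    larger : reg s new ∸ reg s old ≢ 0 → ∣ S ∣ < ∣ C ∣
    larger gain≢0 = subst₂ _<_ old≡ new≡ (m∸n≢0⇒n<m gain≢0)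
    not-larger : reg s new ∸ reg s old ≡ 0 → ∣ C ∣ ≤ ∣ S ∣
    not-larger gain≡0 = subst₂ _≤_ new≡ old≡ (m∸n≡0⇒m≤n gain≡0)

  opaque
    unfolding attempt

    attempt-idle : ∀ s → reg s found ≢ 0 → ⟦ attempt t ⟧ s ≡ s
    attempt-idle s f≢0 with reg s found
    ... | zero  = contradiction refl f≢0
    ... | suc _ = refl

    attempt-run : ∀ s → reg s found ≡ 0 → ⟦ attempt t ⟧ s ≡ ⟦ transfer ▸ edit t order ▸ check ▸ accept t ⟧ s
    attempt-run s f≡0 rewrite f≡0 = refl

  attempt-spec : ∀ S s → Holds S s → reg s found ≡ 0 →
    Accepts S (candidate t (positions s) S) (⟦ attempt t ⟧ s)
  attempt-spec S s (o , h) f≡0 = subst (Accepts S C) (sym (attempt-run s f≡0))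
    -- `accept` reads the positions in the state s₃; the components before it do not assign them, so
    -- the candidate is still that of s.
    (subst (λ D → Accepts S D (⟦ accept t ⟧ s₃)) C₃≡C
      (accept-spec S s₃ (o₃ , λ v → trans (cong (λ μ → μ (toℕ v)) mem₃) (h₂ v))
        (trans (frame check found s₂ refl) (trans (frame-edit found refl refl refl)
          (trans (frame transfer found s refl) f≡0)))
        (trans old₃ (sumBelow-cardinality S (mem s₂) h₂))
        (trans new₃ (trans (sumBelow-cardinality C (λ v → mem s₂ (n + v)) c₂) (cong ∣_∣ (sym C₃≡C))))
        (λ bad≡0 → subst (Independent G) (sym C₃≡C)
          (conflict-free⇒independent {mem s₂} {C} c₂ (trans (sym bad₃) bad≡0)))
        (λ ind → trans bad₃
          (independent⇒conflict-free {mem s₂} {C} c₂ (subst (Independent G) C₃≡C ind)))))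
    where
    s₁ = ⟦ transfer ⟧ s
    s₂ = ⟦ edit t order ⟧ s₁
    s₃ = ⟦ check ⟧ s₂
    C  = candidate t (positions s) S

    frame-edit : ∀ r → (r ≡ᵇ zeroReg) ≡ false → (r ≡ᵇ one) ≡ false → (r ≡ᵇ addr) ≡ false →
      reg s₂ r ≡ reg s₁ r
    frame-edit r p q a = frame (edit t order) r s₁ (edit-assigns t order r p q a)

    o₁ : reg s₁ order ≡ n
    o₁ = trans (frame transfer order s refl) o

    o₂ : reg s₂ order ≡ n
    o₂ = trans (frame-edit order refl refl refl) o₁

    o₃ : reg s₃ order ≡ n
    o₃ = trans (frame check order s₂ refl) o₂

    C₃≡C : candidate t (positions s₃) S ≡ C
    C₃≡C = candidate-cong t S λ j _ → trans (frame check (position j) s₂ refl)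
      (trans (frame-edit (position j) refl refl refl) (frame transfer (position j) s refl))

    h₂ : HoldsAt 0 S s₂
    h₂ v = trans
      (edit-below t order refl s₁ (toℕ v) (≤-trans (Fin.toℕ<n v) (≤-reflexive (sym o₁))))
      (proj₁ (transfer-spec S s (o , h)) v)

    c₂ : HoldsAt n C s₂
    c₂ = subst₂ (λ m D → HoldsAt m D s₂) o₁
      (candidate-cong t S (λ j _ → frame transfer (position j) s refl))
      (edit-spec t order refl S s₁
        (subst (λ m → HoldsAt m S s₁) (sym o₁) (proj₂ (transfer-spec S s (o , h)))))

    checked = check-spec s₂ o₂
    mem₃ = proj₁ checked
    old₃ = proj₁ (proj₂ checked)
    new₃ = proj₁ (proj₂ (proj₂ checked))
    bad₃ = proj₂ (proj₂ (proj₂ checked))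

  module SearchLoop (d : ℕ) = Loop (position d) (search d (attempt t)) refl refl
    (search-assigns-position d (attempt t) (attempt-assigns-position t) d ≤-refl)
    (search-assigns-order d (attempt t) (attempt-assigns-order t))

  -- After a success the loops still run and change position registers, but every attempt is idle,
  -- and `Holds` looks only at `order` and memory.
  search-idle : ∀ d (C : Subset n) s → reg s found ≢ 0 × Holds C s →
    (let s′ = ⟦ search d (attempt t) ⟧ s) → reg s′ found ≢ 0 × Holds C s′
  search-idle zero    C s h@(f≢0 , _) =
    subst (λ s → reg s found ≢ 0 × Holds C s) (sym (attempt-idle s f≢0)) h
  search-idle (suc d) C s h = SearchLoop.invariant d (λ _ s → reg s found ≢ 0 × Holds C s)
    (λ _ s _ _ _ h → search-idle d C s h) s (proj₁ (proj₂ h)) h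

  Found : Subset n → State → Set
  Found S s = reg s found ≢ 0 × ∃[ C ] (Improvement t G S C × Holds C s)

  -- Failure at depth d refutes all tuples that agree with the registers from slot d on and hold
  -- arbitrary vertices below d. Each induction step frees one more slot.
  search-spec : ∀ d S s → reg s found ≡ 0 → Holds S s → (let s′ = ⟦ search d (attempt t) ⟧ s) →
    Found S s′ ⊎
    (reg s′ found ≡ 0 × Holds S s′ ×
     (∀ P → (∀ j → d ≤ j → j < t + t → P j ≡ positions s j) → (∀ j → j < d → P j < n) →
       ¬ Better G S (candidate t P S)))
  search-spec zero    S s f≡0 h with attempt-spec S s h f≡0
  ... | inj₁ (f≢0 , better , h′) = inj₁ (f≢0 , _ , candidate-improvement (positions s) S better , h′)
  ... | inj₂ (f≡0′ , ¬better , h′) = inj₂ (f≡0′ , h′ , λ P eq _ better → ¬better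
    (subst (Better G S) (candidate-cong t S (λ j j< → eq j z≤n j<)) better))
  search-spec (suc d) S s f≡0 h
    with SearchLoop.invariant d I step s (proj₁ h)
           (inj₂ (f≡0 , h ,
                  (λ j d<j → start-loop-other (position d) (position j) s (>⇒≡ᵇ-false d<j) refl) ,
                  λ _ _ _ ()))
    where
    -- After k rounds, the tuples whose slot d is below k are refuted; the slots above d have to
    -- keep their initial values for these refutations to combine.
    I : ℕ → State → Set
    I k s′ = Found S s′ ⊎
      (reg s′ found ≡ 0 × Holds S s′ × (∀ j → d < j → positions s′ j ≡ positions s j) ×
       (∀ P → (∀ j → d < j → j < t + t → P j ≡ positions s j) → (∀ j → j < d → P j < n) →
         P d < k → ¬ Better G S (candidate t P S)))
    step : ∀ k s′ → k < n → positions s′ d ≡ k → reg s′ order ≡ n → I k s′ →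
      I (suc k) (SearchLoop.body d s′)
    step k s′ _ _ _ (inj₁ (f≢0 , C , imp , h)) with search-idle d C s′ (f≢0 , h)
    ... | f≢0′ , h′ = inj₁ (f≢0′ , C , imp , h′)
    step k s′ _ here≡k _ (inj₂ (f≡0 , h , kept , none)) with search-spec d S s′ f≡0 h
    ... | inj₁ success = inj₁ success
    ... | inj₂ (f≡0′ , h′ , none′) = inj₂ (f≡0′ , h′ , kept′ , none″)
      where
      s″ = ⟦ search d (attempt t) ⟧ s′
      kept′ : ∀ j → d < j → positions (advance (position d) s″) j ≡ positions s j
      kept′ j d<j = trans (advance-other (position d) (position j) s″ (>⇒≡ᵇ-false d<j) refl refl)
        (trans (frame (search d (attempt t)) (position j) s′
                 (search-assigns-position d (attempt t) (attempt-assigns-position t) j (<⇒≤ d<j)))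
               (kept j d<j))
      none″ : ∀ P → (∀ j → d < j → j < t + t → P j ≡ positions s j) → (∀ j → j < d → P j < n) →
        P d < suc k → ¬ Better G S (candidate t P S)
      -- A value of slot d below k was refuted in an earlier round; the value k is the content of
      -- the counter register in this round.
      none″ P above below (s≤s Pd≤k) with P d ≟ k
      ... | no  Pd≢k = none P above below (≤∧≢⇒< Pd≤k Pd≢k)
      ... | yes Pd≡k = none′ P agree below
        where
        agree : ∀ j → d ≤ j → j < t + t → P j ≡ positions s′ j
        agree j d≤j j< with d ≟ j
        ... | yes refl = trans Pd≡k (sym here≡k)
        ... | no  d≢j  = trans (above j (≤∧≢⇒< d≤j d≢j) j<) (sym (kept j (≤∧≢⇒< d≤j d≢j)))
  ... | inj₁ success = inj₁ success
  ... | inj₂ (f≡0′ , h′ , _ , none) = inj₂ (f≡0′ , h′ , λ P above below →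
    none P above (λ j j<d → below j (m≤n⇒m≤1+n j<d)) (below d ≤-refl))

  guess-mem : ∀ k s → mem (⟦ guess k ⟧ s) ≡ mem s
  guess-mem zero    s = refl
  guess-mem (suc k) s = guess-mem k s

  guess-tape : ∀ k s j → tape (⟦ guess k ⟧ s) j ≡ tape s (k + j)
  guess-tape zero    s j = refl
  guess-tape (suc k) s j = trans (guess-tape k s (suc j)) (cong (tape s) (+-suc k j))

  guess-frame : ∀ k r s → (∀ j → j < k → (r ≡ᵇ position j) ≡ false) → reg (⟦ guess k ⟧ s) r ≡ reg s r
  guess-frame k r s eq = frame (guess k) r s (guess-assigns k r eq)

  -- `choose` cuts a tape entry at `order`, so an entry below n arrives unchanged and a tape can
  -- dictate any tuple of vertices.
  guess-positions : ∀ k s j → j < k → positions (⟦ guess k ⟧ s) j ≡ tape s j ⊓ reg s order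
  guess-positions (suc k) s j (s≤s j≤k) with j ≟ k
  ... | yes refl = trans (update-here (reg (⟦ guess k ⟧ s)) _ refl)
    (cong₂ _⊓_ (trans (guess-tape k s 0) (cong (tape s) (+-identityʳ k)))
               (guess-frame k order s (λ _ _ → refl)))
  ... | no j≢k   = trans (update-other (reg (⟦ guess k ⟧ s)) _ (j≢k ∘ +-cancelˡ-≡ 16 j k))
    (guess-positions k s j (≤∧≢⇒< j≤k j≢k))

  guessed : State → State
  guessed s = ⟦ guess (t + t) ⟧ (setTo found (const 0) s)

  guessed-found : ∀ s → reg (guessed s) found ≡ 0
  guessed-found s = guess-frame (t + t) found _ (λ _ _ → refl)

  guessed-holds : ∀ (S : Subset n) s → Holds S s → Holds S (guessed s)
  guessed-holds S s (o , h) = trans (guess-frame (t + t) order _ (λ _ _ → refl)) o ,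
    λ v → trans (cong (λ μ → μ (toℕ v)) (guess-mem (t + t) (setTo found (const 0) s))) (h v)

  Outcome : Subset n → State → Set
  Outcome S s =
    (reg s found ≢ 0 × (∃[ S′ ] (Improvement t G S S′ × Holds S′ s)))
      ⊎ (reg s found ≡ 0 × LocallyOptimal t G S × Holds S s)

  improvement-spec : ∀ S s → Holds S s → Outcome S (⟦ improvement t ⟧ s)
  improvement-spec S s h
    with attempt-spec S (guessed s) (guessed-holds S s h) (guessed-found s)
  ... | inj₁ (f≢0 , better , h′)
    with search-idle (t + t) (candidate t (positions (guessed s)) S) (⟦ attempt t ⟧ (guessed s)) (f≢0 , h′)
  ...   | f≢0″ , h″ = inj₁ (f≢0″ , _ , candidate-improvement (positions (guessed s)) S better , h″)
  improvement-spec S s h | inj₂ (f≡0 , _ , h′)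
    with search-spec (t + t) S (⟦ attempt t ⟧ (guessed s)) f≡0 h′
  ... | inj₁ success = inj₁ success
  ... | inj₂ (f≡0′ , h″ , none) = inj₂ (f≡0′ , optimal , h″)
    where
    optimal : LocallyOptimal t G S
    optimal (S′ , imp) with improvement-candidate imp
    -- All 2t slots are free at this depth, so the agreement condition is vacuous.
    ... | P , P<n , refl = none P (λ j 2t≤j j<2t → contradiction j<2t (≤⇒≯ 2t≤j)) (λ j _ → P<n j)
      (Improvement.independent imp , Improvement-grows imp)

  -- The tape spells out the slots of the wanted improvement; the first attempt accepts it, and the
  -- search that follows is idle.
  improvement-any : ∀ S S′ → Improvement t G S S′ → ∀ s → Holds S s →
    ∃[ ω ] (let s′ = ⟦ improvement t ⟧ (record s { tape = ω }) in reg s′ found ≢ 0 × Holds S′ s′)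
  improvement-any S S′ imp s h with improvement-candidate imp
  ... | P , P<n , eq = P , search-idle (t + t) S′ (⟦ attempt t ⟧ s₁) attempted
    where
    s₁ = guessed (record s { tape = P })
    C≡S′ : candidate t (positions s₁) S ≡ S′
    C≡S′ = trans (candidate-cong t S λ j j< →
      trans (guess-positions (t + t) (setTo found (const 0) (record s { tape = P })) j j<)
            (m≤n⇒m⊓n≡m (≤-trans (<⇒≤ (P<n j)) (≤-reflexive (sym (proj₁ h)))))) eq
    attempted : reg (⟦ attempt t ⟧ s₁) found ≢ 0 × Holds S′ (⟦ attempt t ⟧ s₁)
    attempted with attempt-spec S s₁ (guessed-holds S (record s { tape = P }) h) (guessed-found _)
    ... | inj₁ (f≢0 , _ , h′)     = f≢0 , subst (λ C → Holds C (⟦ attempt t ⟧ s₁)) C≡S′ h′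
    ... | inj₂ (_ , ¬better , _) = contradiction
      (subst (Better G S) (sym C≡S′) (Improvement.independent imp , Improvement-grows imp)) ¬better

  exec-improvement : ∀ s → reg s order ≡ n →
    ∃[ k ] (G ⊢⟨ compile (improvement t) , s ⟩⇓⟨ ⟦ improvement t ⟧ s , k ⟩ × k ≤ cost n (improvement t))
  exec-improvement = exec (improvement t) (improvement-loopSafe t) (improvement-assigns-order t)

  private
    step-cost : ℕ
    step-cost = suc (cost n (improvement t))

  -- `fuel` bounds n minus |S| and drops with every success, as improvements enlarge the set. One
  -- further round detects local optimality, whence `suc fuel`.
  iterate-improvement : ∀ fuel S s → n ≤ ∣ S ∣ + fuel → Holds S s → reg s found ≢ 0 →
    ∃[ s′ ] ∃[ k ] (G ⊢⟨ while found (compile (improvement t)) , s ⟩⇓⟨ s′ , k ⟩ ×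
      k ≤ suc fuel * step-cost + 1 ×
      (∃[ S′ ] (Star (Improvement t G) S S′ × LocallyOptimal t G S′ × Holds S′ s′)))
  iterate-improvement fuel S s n≤ h f≢0 with exec-improvement s (proj₁ h) | improvement-spec S s h
  ... | k , run , k≤ | inj₂ (f≡0 , opt , h′) =
    _ , _ , while-loop⇓ f≢0 run (while-stop⇓ f≡0) ,
    +-monoˡ-≤ 1 (≤-trans (s≤s k≤) (m≤m+n step-cost (fuel * step-cost))) , S , ε , opt , h′
  iterate-improvement zero S s n≤ h f≢0 | _ | inj₁ (_ , S′ , imp , _) =
    contradiction (∣p∣≤n S′)
      (<⇒≱ (≤-<-trans (≤-trans n≤ (≤-reflexive (+-identityʳ ∣ S ∣))) (Improvement-grows imp)))
  iterate-improvement (suc fuel) S s n≤ h f≢0 | k , run , k≤ | inj₁ (f≢0′ , S′ , imp , h′)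
    with iterate-improvement fuel S′ (⟦ improvement t ⟧ s)
           (≤-trans n≤ (≤-trans (≤-reflexive (+-suc ∣ S ∣ fuel)) (+-monoˡ-≤ fuel (Improvement-grows imp)))) h′ f≢0′
  ... | s″ , l , run′ , l≤ , S″ , path , opt , h″ =
    s″ , _ , while-loop⇓ f≢0 run run′ ,
    ≤-trans (+-mono-≤ (s≤s k≤) l≤) (≤-reflexive (sym (+-assoc step-cost (suc fuel * step-cost) 1))) ,
    S″ , imp ◅ path , opt , h″

-- Running time

-- Two initial instructions, at most n successful rounds and a failing one, each with its loop test,
-- and the final test of `found`.
localSearch-cost : ℕ → ℕ → ℕ
localSearch-cost t n = 2 + (suc n * suc (cost n (improvement t)) + 1)

localSearch-polynomial : ∀ t → Polynomial (localSearch-cost t)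
localSearch-polynomial t = +-polynomial (const-polynomial 2)
  (+-polynomial
    (*-polynomial (+-polynomial (const-polynomial 1) id-polynomial)
                  (+-polynomial (const-polynomial 1) (cost-polynomial (improvement t))))
    (const-polynomial 1))

runsInPolynomialTime : ∀ t → RunsInPolynomialTime t
runsInPolynomialTime t with localSearch-polynomial t
... | c , d , bound = compile (improvement t) , improves , c , d , terminates
  where
  improves : Improves t (compile (improvement t))
  improves = record
    { step = λ G S _ s h → let open Correctness G t; k , run , _ = exec-improvement s (proj₁ h) in
        _ , k , run , improvement-spec S s h
    ; any-choice = λ G S _ S′ imp s h →
        let open Correctness G t
            ω , f≢0 , h′ = improvement-any S S′ imp s h
            k , run , _  = exec-improvement (record s { tape = ω }) (proj₁ h)
        in ω , _ , k , run , f≢0 , h′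
    }

  terminates : ∀ {n} (G : Graph (Fin n)) (v : Fin n) (ω : ℕ → ℕ) →
    ∃[ s ] ∃[ k ] (G ⊢⟨ localSearch (compile (improvement t)) , initial n v ω ⟩⇓⟨ s , k ⟩ ×
      k ≤ c * n ^ d × (∃[ S ] (OutputFrom t G v S × Holds S s)))
  terminates {n} G v ω
    with Correctness.iterate-improvement G t n ⁅ v ⁆ s₁ (m≤n+m n ∣ ⁅ v ⁆ ∣) (refl , holds) (λ ())
    where
    s₁ : State
    -- The state after the two initial instructions: `found` supplies the 1 that marks `v` and also
    -- opens the loop.
    s₁ = let s₀ = setReg found 1 (initial n v ω) in
         record s₀ { mem = mem s₀ [ reg s₀ start ↦ reg s₀ found ] }
    holds : ∀ w → mem s₁ (toℕ w) ≡ bit (lookup ⁅ v ⁆ w)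
    holds w with w Fin.≟ v
    ... | yes refl = trans (update-here (λ _ → 0) {toℕ v} 1 refl) (cong bit (sym ([]=⇒lookup (x∈⁅x⁆ v))))
    ... | no w≢v   = trans (update-other (λ _ → 0) {toℕ v} 1 (w≢v ∘ Fin.toℕ-injective))
                       (cong bit (sym outside-⁅v⁆))
      where
      outside-⁅v⁆ : lookup ⁅ v ⁆ w ≡ false
      outside-⁅v⁆ = Bool.¬-not (w≢v ∘ x∈⁅y⁆⇒x≡y v ∘ lookup⇒[]= w ⁅ v ⁆)
  ... | s , k , run , k≤ , S , path , opt , h =
    s , _ , ⨾⇓ ≔⇓ (⨾⇓ mem⇓ run) ,
    ≤-trans (s≤s (s≤s k≤)) (bound n (≤-trans (s≤s z≤n) (Fin.toℕ<n v))) ,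
    S , (path , opt) , h

theorem18 : (t : ℕ) → 2 ≤ t → RunsInPolynomialTime t × ApproximatesMIS t
theorem18 t 2≤t = runsInPolynomialTime t , approximatesMIS t (<⇒≤ 2≤t)
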